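{- Let $D=(V,A)$ be a digraph such that there exist no two distinct vertices $u,v$ with both $(u,v)\in A$ and $(v,u)\in A$. (a) $U_D$ is $p$-positive: $U_D\in\mathbb{N}[p_1,p_2,p_3,\dots]$. (b) Call a rotation-equivalence class $\gamma$ of nonempty tuples of elements of $V$ risky if its length is even and either $\gamma$ or the reversal of $\gamma$ is a $D$-cycle. Then \[U_D=\sum_{\substack{\sigma\in\mathfrak{S}_V(D,\overline{D});\\ \text{no cycle of }\sigma\text{ is risky}}}p_{\operatorname{type}\sigma}.\]
   Context: A digraph is $D=(V,A)$ with $V$ finite, $A\subseteq V\times V$; $\overline{D}=(V,(V\times V)\setminus A)$; $n=|V|$. A $V$-listing is a tuple $w=(w_1,\dots,w_n)$ containing each element of $V$ exactly once; $\operatorname{Des}(w,D)=\{i\in[n-1]:(w_i,w_{i+1})\in A\}$; $L_{I,n}=\sum x_{i_1}\cdots x_{i_n}$ over positive integers $i_1\le\cdots\le i_n$ with $i_p<i_{p+1}$ for $p\in I$; $U_D=\sum_w L_{\operatorname{Des}(w,D),n}$ over all $V$-listings. Two nonempty tuples are rotation-equivalent if one is a cyclic rotation of the other; the length of a class is that of its tuples; the reversal of the class of $(v_1,\dots,v_k)$ is the class of $(v_k,\dots,v_1)$; $\operatorname{CArcs}$ of that class is $\{(v_1,v_2),\dots,(v_{k-1},v_k),(v_k,v_1)\}$. A $D$-cycle is a rotation-equivalence class $\gamma$ of nonempty tuples of distinct elements of $V$ with $\operatorname{CArcs}\gamma\subseteq A$ (analogously $\overline{D}$-cycle). The cycles of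 $\sigma\in\mathfrak{S}_V$ are the classes of $(i,\sigma(i),\dots,\sigma^{k-1}(i))$ with $k$ minimal such that $\sigma^k(i)=i$. $\mathfrak{S}_V(D,\overline{D})$ is the set of $\sigma\in\mathfrak{S}_V$ all of whose cycles are $D$-cycles or $\overline{D}$-cycles. $\operatorname{type}\sigma$ is the partition of cycle lengths; $p_k=\sum_i x_i^k$, $p_\lambda=\prod_j p_{\lambda_j}$. -}

module Defs where

open import Data.Nat using (ℕ; zero; suc; _+_; _*_; _∸_; _≡ᵇ_; _<ᵇ_; _≤ᵇ_)
open import Data.Bool using (Bool; true; false; if_then_else_; _∧_; _∨_; not)
open import Data.List using (List; []; _∷_; [_]; map; foldr; concatMap; upTo;
  length; replicate; _++_; filterᵇ; zip; reverse)
open import Data.Bool.ListAction using (all; any)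
open import Data.Nat.ListAction using (sum)
open import Data.Product using (_×_; _,_; proj₁; proj₂)
open import Data.Fin using (Fin; toℕ)
open import Data.Fin.Properties using (_≟_)
open import Data.List using (allFin)
open import Data.Vec using (Vec; lookup; toList) renaming ([] to []ᵥ; _∷_ to _∷ᵥ_)
open import Relation.Nullary using (does)

-- Formal power series in x₁, x₂, … with ℕ coefficients, represented by
-- their coefficient function: a monomial x₁^{a₁}⋯x_k^{a_k} is the list
-- (a₁ , … , a_k) (trailing zeros are harmless: all series below give the
-- same coefficient for α and α ++ [0]).

Series : Set
Series = List ℕ → ℕ

_⊕_ : Series → Series → Series
(f ⊕ g) α = f α + g α

zeroS : Series
zeroS _ = 0

ΣS : List Series → Series
ΣS = foldr _⊕_ zeroS

oneS : Series
oneS α = if all (λ a → a ≡ᵇ 0) α then 1 else 0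

splits : List ℕ → List (List ℕ × List ℕ)
splits [] = [ ([] , []) ]
splits (a ∷ α) =
  concatMap (λ b → map (λ p → (b ∷ proj₁ p , (a ∸ b) ∷ proj₂ p)) (splits α)) (upTo (suc a))

_⊗_ : Series → Series → Series
(f ⊗ g) α = sum (map (λ p → f (proj₁ p) * g (proj₂ p)) (splits α))

-- power sum p_k = Σ_i x_i^k  (used only for k ≥ 1)
powerSum : ℕ → Series
powerSum k [] = 0
powerSum k (a ∷ α) =
  (if a ≡ᵇ k then oneS α else 0) + (if a ≡ᵇ 0 then powerSum k α else 0)

pλ : List ℕ → Series
pλ λs = foldr (λ k s → powerSum k ⊗ s) oneS λs

-- Fundamental quasisymmetric function L_{I,n}, I ⊆ {1,…,n-1} given as a
-- predicate on positive integers. The coefficient of x^α counts weakly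
-- increasing i₁ ≤ ⋯ ≤ i_n with content α and i_p < i_{p+1} for p ∈ I;
-- the only candidate sequence is `expand α`.

expandFrom : ℕ → List ℕ → List ℕ
expandFrom i [] = []
expandFrom i (a ∷ α) = replicate a i ++ expandFrom (suc i) α

expand : List ℕ → List ℕ
expand = expandFrom 1

strictAt : (ℕ → Bool) → ℕ → List ℕ → Bool
strictAt I p (x ∷ y ∷ s) = (not (I p) ∨ (x <ᵇ y)) ∧ strictAt I (suc p) (y ∷ s)
strictAt I p _ = true

L : (ℕ → Bool) → ℕ → Series
L I n α = if (length (expand α) ≡ᵇ n) ∧ strictAt I 1 (expand α) then 1 else 0

-- Digraphs on V = Fin n, arcs given by a Boolean matrix A.

_==_ : {n : ℕ} → Fin n → Fin n → Bool
u == v = does (u ≟ v)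

tuples : (n k : ℕ) → List (Vec (Fin n) k)
tuples n zero = [ []ᵥ ]
tuples n (suc k) = concatMap (λ v → map (v ∷ᵥ_) (tuples n k)) (allFin n)

occ : {n : ℕ} → Fin n → List (Fin n) → ℕ
occ v w = length (filterᵇ (λ x → x == v) w)

isListing : {n : ℕ} → Vec (Fin n) n → Bool
isListing {n} w = all (λ v → occ v (toList w) ≡ᵇ 1) (allFin n)

listings : (n : ℕ) → List (Vec (Fin n) n)
listings n = filterᵇ isListing (tuples n n)

-- Des(w,D) as a predicate on positive integers p: (w_p , w_{p+1}) ∈ A
desAt : {n : ℕ} → (Fin n → Fin n → Bool) → List (Fin n) → ℕ → Bool
desAt A (x ∷ y ∷ s) (suc zero) = A x y
desAt A (x ∷ s) (suc (suc p)) = desAt A s (suc p)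
desAt A _ _ = false

U : {n : ℕ} → (Fin n → Fin n → Bool) → Series
U {n} A = ΣS (map (λ w → L (desAt A (toList w)) n) (listings n))

-- Permutations of V: σ is given by the listing (σ(0),…,σ(n-1)).

orbitGo : {n : ℕ} → (Fin n → Fin n) → Fin n → ℕ → Fin n → List (Fin n)
orbitGo σ i zero x = []
orbitGo σ i (suc f) x = if x == i then [] else x ∷ orbitGo σ i f (σ x)

orbit : {n : ℕ} → (Fin n → Fin n) → Fin n → List (Fin n)
orbit {n} σ i = i ∷ orbitGo σ i n (σ i)

-- the cycles of σ, each listed once (represented by the tuple starting
-- at its least element)
cycles : {n : ℕ} → (Fin n → Fin n) → List (List (Fin n))
cycles {n} σ = map (orbit σ)
  (filterᵇ (λ i → all (λ j → toℕ i ≤ᵇ toℕ j) (orbit σ i)) (allFin n))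

type : {n : ℕ} → (Fin n → Fin n) → List ℕ
type σ = map length (cycles σ)

carcs : {n : ℕ} → List (Fin n) → List (Fin n × Fin n)
carcs [] = []
carcs (v ∷ vs) = zip (v ∷ vs) (vs ++ [ v ])

nonempty : {A : Set} → List A → Bool
nonempty [] = false
nonempty (_ ∷ _) = true

distinct : {n : ℕ} → List (Fin n) → Bool
distinct w = all (λ v → occ v w ≡ᵇ 1) w

isCycle : {n : ℕ} → (Fin n → Fin n → Bool) → List (Fin n) → Bool
isCycle A γ = nonempty γ ∧ distinct γ ∧ all (λ e → A (proj₁ e) (proj₂ e)) (carcs γ)

co : {n : ℕ} → (Fin n → Fin n → Bool) → Fin n → Fin n → Bool
co A u v = not (A u v)

evenᵇ : ℕ → Bool
evenᵇ zero = true
evenᵇ (suc zero) = false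
evenᵇ (suc (suc k)) = evenᵇ k

risky : {n : ℕ} → (Fin n → Fin n → Bool) → List (Fin n) → Bool
risky A γ = nonempty γ ∧ evenᵇ (length γ) ∧ (isCycle A γ ∨ isCycle A (reverse γ))

admissible : {n : ℕ} → (Fin n → Fin n → Bool) → Vec (Fin n) n → Bool
admissible A w =
  all (λ γ → isCycle A γ ∨ isCycle (co A) γ) (cycles (lookup w))
  ∧ not (any (risky A) (cycles (lookup w)))

RHS : {n : ℕ} → (Fin n → Fin n → Bool) → Series
RHS {n} A = ΣS (map (λ w → pλ (type (lookup w))) (filterᵇ (admissible A) (listings n)))

{-# OPTIONS --safe #-}

-- The coefficient of x^α in U_D counts the ways to cut V into consecutive blocks of sizes α₁, α₂, …
-- together with a Hamiltonian path of the complement on each block, while the coefficient of x^α in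
-- p_(type σ) counts the colourings of content α that are constant on the cycles of σ.  So everything
-- rests on the one-variable identity.  Weigh a path by the product of β = 1 + τ over its arcs, where
-- τ = -[arc of D].  Writing a Hamiltonian path through v as p v q and telescoping β = 1 + τ twice,
-- once towards v along p and once around the cycle through v, gives
--
--   paths (V ∪ {v}) = Σ_C (Σ over cycles on C ∪ {v} of Π β - Π τ) · paths (V ∖ C),
--
-- and Π β - Π τ is the signed indicator of a D-cycle or D̄-cycle.  Reversal of cycles through v then
-- cancels the even D-cycles against their reversals, which are D̄-cycles because D has no 2-cycles.
module Submission where

open import Algebra.Properties.AbelianGroup using (∙-cancelʳ)
open import Defs
open import Data.Bool using (Bool; true; false; if_then_else_; _∧_; _∨_; not; T; T?)
open import Data.Bool.ListAction using (all; any)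
open import Data.Bool.Properties using (∧-assoc; ∧-comm; ∧-identityʳ; ∧-zeroʳ; ∧-conicalˡ; ∧-conicalʳ; ∨-zeroʳ; ∨-identityʳ; T-≡)
open import Data.Empty using (⊥; ⊥-elim)
open import Data.Fin as Fin using (Fin; zero; suc; toℕ)
open import Data.Fin.Properties using (_≟_)
open import Data.Integer using (ℤ; +_; 0ℤ; 1ℤ; -1ℤ; _+_; _*_; -_; _-_)
open import Data.Integer.Properties using (+-identityˡ; +-identityʳ; +-assoc; +-comm; +-injective; +-0-abelianGroup; *-zeroʳ; *-zeroˡ; *-distribˡ-+; *-comm; *-assoc; *-identityˡ; *-identityʳ; pos-+; pos-*)
open import Data.Integer.Tactic.RingSolver using (solve-∀)
open import Data.List using (List; []; _∷_; [_]; map; concat; concatMap; _++_; length; reverse; replicate; zip; filter; filterᵇ; upTo; allFin)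
open import Data.List.Membership.DecPropositional using () renaming (_∈?_ to member?)
open import Data.List.Membership.Propositional using (_∈_; _∉_; find; lose)
open import Data.List.Membership.Propositional.Properties using (∈-map⁺; ∈-map⁻; ∈-++⁺ˡ; ∈-++⁺ʳ; ∈-++⁻; ∈-concatMap⁺; ∈-concatMap⁻; ∈-concat⁻′; ∈-∃++; ∈-filter⁺; ∈-filter⁻; ∈-allFin)
open import Data.List.Properties using (++-assoc; ++-identityʳ; length-++; length-map; length-reverse; length-filter; length-tabulate; map-∘; map-upTo; unfold-reverse; reverse-++; reverse-injective; ∷-injectiveˡ; ∷-injectiveʳ)
open import Data.List.Relation.Binary.Permutation.Propositional as ↭ using (_↭_; ↭-sym; ↭-trans; ↭-prep)
open import Data.List.Relation.Binary.Permutation.Propositional.Properties using (shift; drop-mid; ++⁺; ↭-length; ↭-reverse; ↭-empty-inv; ∈-resp-↭)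
import Data.List.Relation.Binary.Permutation.Setoid.Properties as ↭ₛ
open import Data.List.Relation.Unary.All as All using (All; []; _∷_)
import Data.List.Relation.Unary.All.Properties as Allₚ
open import Data.List.Relation.Unary.AllPairs as AllPairs using (AllPairs; []; _∷_)
import Data.List.Relation.Unary.AllPairs.Properties as AllPairsₚ
open import Data.List.Relation.Unary.Any using (here; there)
open import Data.List.Relation.Unary.Unique.Propositional using (Unique)
import Data.List.Relation.Unary.Unique.Propositional.Properties as Uniqueₚ
open import Data.Nat as ℕ using (ℕ; zero; suc; _∸_; _≡ᵇ_; _<ᵇ_; _≤ᵇ_; _≤_; s≤s; z≤n)
open import Data.Nat.ListAction using (sum)
import Data.Nat.Properties as ℕₚ
open import Data.Product using (Σ; _×_; _,_; proj₁; proj₂; map₁; map₂)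
open import Data.Sum using (_⊎_; inj₁; inj₂)
open import Data.Vec using (Vec; lookup; toList; fromList) renaming ([] to []ᵥ; _∷_ to _∷ᵥ_)
open import Data.Vec.Properties using (length-toList; toList∘fromList; tabulate∘lookup; tabulate-cong) renaming (∷-injectiveˡ to ∷ᵥ-injectiveˡ; ∷-injectiveʳ to ∷ᵥ-injectiveʳ)
open import Function using (_∘_; flip; Equivalence)
open import Relation.Binary.PropositionalEquality using (_≡_; _≢_; refl; sym; trans; cong; cong₂; subst; setoid; module ≡-Reasoning)
open import Relation.Nullary using (¬_; Dec; yes; no; does; ¬?)
open import Relation.Unary using (Decidable)
open ≡-Reasoning

-- The passage from one variable to several rests on where a chosen vertex `v` sits. It lies in
-- exactly one block, and taking its cycle `v ∷ C` out of that block leaves a block decomposition of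
-- the remaining vertices `R`. So the series of `v ∷ V` is the sum over `C` of the cycle weight
-- times the power sum of index `suc (length C)` times the series of `R`. Iterated with `v` always
-- the first vertex left, this produces decompositions into cycles led by their least elements, and
-- those match the permutations. The cancellation takes place inside one factor of this recursion,
-- with `v` and the vertex set `C` fixed. Hence no sign-reversing involution on permutations is
-- built: reversing `c` permutes the arrangements of a single list. Negative weights do occur on the
-- way, so all sums are taken in ℤ, and injectivity of the embedding of ℕ brings the result back.

private variable
  X Y : Set
  n k : ℕ

-- Sums over cuts, shares and arrangements of a list

interchange : ∀ a b c d → (a + b) + (c + d) ≡ (a + c) + (b + d)
interchange = solve-∀

+-exchange : ∀ a b c → a + (b + c) ≡ b + (a + c)
+-exchange = solve-∀

-- Opacity keeps `∑ xs f` from computing, so that unification can read `f` off a goal and the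
-- summands written `_` in long chains are solved.
opaque
  ∑ : List X → (X → ℤ) → ℤ
  ∑ []       f = 0ℤ
  ∑ (x ∷ xs) f = f x + ∑ xs f

  ∑-[] : (f : X → ℤ) → ∑ [] f ≡ 0ℤ
  ∑-[] f = refl

  ∑-∷ : (x : X) (xs : List X) (f : X → ℤ) → ∑ (x ∷ xs) f ≡ f x + ∑ xs f
  ∑-∷ x xs f = refl

  ∑-[-] : (x : X) (f : X → ℤ) → ∑ [ x ] f ≡ f x
  ∑-[-] x f = +-identityʳ (f x)

  ∑-cong : {f g : X → ℤ} (xs : List X) → (∀ {x} → x ∈ xs → f x ≡ g x) → ∑ xs f ≡ ∑ xs g
  ∑-cong []       e = refl
  ∑-cong (x ∷ xs) e = cong₂ _+_ (e (here refl)) (∑-cong xs (e ∘ there))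

  ∑-ext : {f g : X → ℤ} (xs : List X) → (∀ x → f x ≡ g x) → ∑ xs f ≡ ∑ xs g
  ∑-ext xs e = ∑-cong xs (λ {x} _ → e x)

  ∑-++ : (xs ys : List X) (f : X → ℤ) → ∑ (xs ++ ys) f ≡ ∑ xs f + ∑ ys f
  ∑-++ []       ys f = sym (+-identityˡ _)
  ∑-++ (x ∷ xs) ys f = trans (cong (_+_ (f x)) (∑-++ xs ys f)) (sym (+-assoc (f x) _ _))

  ∑-map : (h : X → Y) (xs : List X) (f : Y → ℤ) → ∑ (map h xs) f ≡ ∑ xs (f ∘ h)
  ∑-map h []       f = refl
  ∑-map h (x ∷ xs) f = cong (_+_ (f (h x))) (∑-map h xs f)

  ∑-concatMap : (h : X → List Y) (xs : List X) (f : Y → ℤ) →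
    ∑ (concatMap h xs) f ≡ ∑ xs (λ x → ∑ (h x) f)
  ∑-concatMap h []       f = refl
  ∑-concatMap h (x ∷ xs) f =
    trans (∑-++ (h x) _ f) (cong (_+_ (∑ (h x) f)) (∑-concatMap h xs f))

  ∑-+ : (xs : List X) (f g : X → ℤ) → ∑ xs (λ x → f x + g x) ≡ ∑ xs f + ∑ xs g
  ∑-+ []       f g = refl
  ∑-+ (x ∷ xs) f g =
    trans (cong (_+_ (f x + g x)) (∑-+ xs f g)) (interchange (f x) (g x) _ _)

  ∑-*ˡ : (k : ℤ) (xs : List X) (f : X → ℤ) → k * ∑ xs f ≡ ∑ xs (λ x → k * f x)
  ∑-*ˡ k []       f = *-zeroʳ k
  ∑-*ˡ k (x ∷ xs) f = trans (*-distribˡ-+ k (f x) _) (cong (_+_ (k * f x)) (∑-*ˡ k xs f))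

  ∑-*ʳ : (k : ℤ) (xs : List X) (f : X → ℤ) → ∑ xs f * k ≡ ∑ xs (λ x → f x * k)
  ∑-*ʳ k xs f = trans (*-comm _ k) (trans (∑-*ˡ k xs f) (∑-ext xs λ x → *-comm k (f x)))

  ∑-zero : (xs : List X) → ∑ xs (λ _ → 0ℤ) ≡ 0ℤ
  ∑-zero []       = refl
  ∑-zero (x ∷ xs) = trans (+-identityˡ _) (∑-zero xs)

  ∑-swap : (xs : List X) (ys : List Y) (f : X → Y → ℤ) →
    ∑ xs (λ x → ∑ ys (f x)) ≡ ∑ ys (λ y → ∑ xs (λ x → f x y))
  ∑-swap []       ys f = sym (∑-zero ys)
  ∑-swap (x ∷ xs) ys f =
    trans (cong (_+_ (∑ ys (f x))) (∑-swap xs ys f)) (sym (∑-+ ys (f x) _))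

  ∑-product : (xs : List X) (ys : List Y) (f : X → ℤ) (g : Y → ℤ) →
    ∑ xs (λ x → ∑ ys (λ y → f x * g y)) ≡ ∑ xs f * ∑ ys g
  ∑-product xs ys f g =
    trans (∑-ext xs λ x → sym (∑-*ˡ (f x) ys g)) (sym (∑-*ʳ (∑ ys g) xs f))

  ∑-↭ : {xs ys : List X} (f : X → ℤ) → xs ↭ ys → ∑ xs f ≡ ∑ ys f
  ∑-↭ f ↭.refl          = refl
  ∑-↭ f (↭.prep x p)    = cong (_+_ (f x)) (∑-↭ f p)
  ∑-↭ f (↭.swap x y p) =
    trans (cong (λ s → f x + (f y + s)) (∑-↭ f p)) (+-exchange (f x) (f y) _)
  ∑-↭ f (↭.trans p q)   = trans (∑-↭ f p) (∑-↭ f q)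

cuts : List X → List (List X × List X)
cuts []      = [ ([] , []) ]
cuts (x ∷ w) = ([] , x ∷ w) ∷ map (map₁ (x ∷_)) (cuts w)

-- The unshuffling coproduct, as `cuts` is the deconcatenation coproduct. The laws below are
-- coassociativity for both and cocommutativity for this one.
shares : List X → List (List X × List X)
shares []      = [ ([] , []) ]
shares (x ∷ V) = map (map₁ (x ∷_)) (shares V) ++ map (map₂ (x ∷_)) (shares V)

perms : List X → List (List X)
perms []      = [ [] ]
perms (x ∷ V) = concatMap (λ w → map (λ (p , q) → p ++ x ∷ q) (cuts w)) (perms V)

∑-cuts-∷ : (x : X) (w : List X) (f : List X × List X → ℤ) →
  ∑ (cuts (x ∷ w)) f ≡ f ([] , x ∷ w) + ∑ (cuts w) (λ (p , q) → f (x ∷ p , q))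
∑-cuts-∷ x w f = trans (∑-∷ _ _ f) (cong (_+_ (f ([] , x ∷ w))) (∑-map (map₁ (x ∷_)) (cuts w) f))

∑-shares-∷ : (x : X) (V : List X) (f : List X × List X → ℤ) →
  ∑ (shares (x ∷ V)) f
    ≡ ∑ (shares V) (λ (s , r) → f (x ∷ s , r)) + ∑ (shares V) (λ (s , r) → f (s , x ∷ r))
∑-shares-∷ x V f = trans (∑-++ (map (map₁ (x ∷_)) (shares V)) _ f)
  (cong₂ _+_ (∑-map (map₁ (x ∷_)) (shares V) f) (∑-map (map₂ (x ∷_)) (shares V) f))

∑-perms-∷ : (x : X) (V : List X) (f : List X → ℤ) →
  ∑ (perms (x ∷ V)) f ≡ ∑ (perms V) (λ w → ∑ (cuts w) (λ (p , q) → f (p ++ x ∷ q)))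
∑-perms-∷ x V f = trans (∑-concatMap _ (perms V) f)
  (∑-ext (perms V) λ w → ∑-map _ (cuts w) f)

∑-cuts-assoc : (w : List X) (f : List X → List X → List X → ℤ) →
  ∑ (cuts w) (λ (u , r) → ∑ (cuts u) (λ (p , q) → f p q r))
    ≡ ∑ (cuts w) (λ (p , u) → ∑ (cuts u) (λ (q , r) → f p q r))
∑-cuts-assoc []      f = trans
  (trans (∑-[-] _ _) (∑-[-] _ _)) (sym (trans (∑-[-] _ _) (∑-[-] _ _)))
∑-cuts-assoc (x ∷ w) f = begin
  ∑ (cuts (x ∷ w)) (λ (u , r) → ∑ (cuts u) (λ (p , q) → f p q r))
    ≡⟨ ∑-cuts-∷ x w _ ⟩
  ∑ [ [] , [] ] (λ (p , q) → f p q (x ∷ w)) + ∑ (cuts w) (λ (u , r) → ∑ (cuts (x ∷ u)) (λ (p , q) → f p q r))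
    ≡⟨ cong₂ _+_ (∑-[-] _ _) (∑-ext (cuts w) λ (u , r) → ∑-cuts-∷ x u _) ⟩
  f [] [] (x ∷ w) + ∑ (cuts w) (λ (u , r) → f [] (x ∷ u) r + ∑ (cuts u) (λ (p , q) → f (x ∷ p) q r))
    ≡⟨ cong (_+_ (f [] [] (x ∷ w))) (∑-+ (cuts w) _ _) ⟩
  f [] [] (x ∷ w) + (∑ (cuts w) (λ (u , r) → f [] (x ∷ u) r)
    + ∑ (cuts w) (λ (u , r) → ∑ (cuts u) (λ (p , q) → f (x ∷ p) q r)))
    ≡⟨ sym (+-assoc (f [] [] (x ∷ w)) _ _) ⟩
  (f [] [] (x ∷ w) + ∑ (cuts w) (λ (u , r) → f [] (x ∷ u) r))
    + ∑ (cuts w) (λ (u , r) → ∑ (cuts u) (λ (p , q) → f (x ∷ p) q r))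
    ≡⟨ cong₂ _+_ (sym (∑-cuts-∷ x w _)) (∑-cuts-assoc w (f ∘ (x ∷_))) ⟩
  ∑ (cuts (x ∷ w)) (λ (q , r) → f [] q r)
    + ∑ (cuts w) (λ (p , u) → ∑ (cuts u) (λ (q , r) → f (x ∷ p) q r))
    ≡⟨ sym (∑-cuts-∷ x w _) ⟩
  ∑ (cuts (x ∷ w)) (λ (p , u) → ∑ (cuts u) (λ (q , r) → f p q r)) ∎

-- A cut falls either before `x`, hence inside `p`, or after it, hence inside `q`.
∑-cuts-insert : (p : List X) (x : X) (q : List X) (f : List X × List X → ℤ) →
  ∑ (cuts (p ++ x ∷ q)) f
    ≡ ∑ (cuts p) (λ (p₁ , p₂) → f (p₁ , p₂ ++ x ∷ q)) + ∑ (cuts q) (λ (q₁ , q₂) → f (p ++ x ∷ q₁ , q₂))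
∑-cuts-insert [] x q f =
  trans (∑-cuts-∷ x q f) (cong (_+ ∑ (cuts q) (λ (q₁ , q₂) → f (x ∷ q₁ , q₂))) (sym (∑-[-] _ _)))
∑-cuts-insert (y ∷ p) x q f = begin
  ∑ (cuts (y ∷ p ++ x ∷ q)) f
    ≡⟨ ∑-cuts-∷ y (p ++ x ∷ q) f ⟩
  f ([] , y ∷ p ++ x ∷ q) + ∑ (cuts (p ++ x ∷ q)) (λ (u , v) → f (y ∷ u , v))
    ≡⟨ cong (_+_ (f ([] , y ∷ p ++ x ∷ q))) (∑-cuts-insert p x q _) ⟩
  f ([] , y ∷ p ++ x ∷ q) + (∑ (cuts p) (λ (p₁ , p₂) → f (y ∷ p₁ , p₂ ++ x ∷ q)) + _)
    ≡⟨ sym (+-assoc (f ([] , y ∷ p ++ x ∷ q)) _ _) ⟩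
  (f ([] , y ∷ p ++ x ∷ q) + ∑ (cuts p) (λ (p₁ , p₂) → f (y ∷ p₁ , p₂ ++ x ∷ q))) + _
    ≡⟨ cong (_+ ∑ (cuts q) (λ (q₁ , q₂) → f (y ∷ p ++ x ∷ q₁ , q₂))) (sym (∑-cuts-∷ y p _)) ⟩
  ∑ (cuts (y ∷ p)) (λ (p₁ , p₂) → f (p₁ , p₂ ++ x ∷ q)) + _ ∎

-- Cutting an arrangement amounts to choosing which entries go left and arranging both parts
-- independently. In the induction the cut passes before or after the inserted `x`; coassociativity
-- of `cuts` then regroups the pieces so that `x` is inserted within a single part.
∑-perms-cuts : (V : List X) (g : List X → List X → ℤ) →
  ∑ (perms V) (λ w → ∑ (cuts w) (λ (p , q) → g p q))
    ≡ ∑ (shares V) (λ (s , r) → ∑ (perms s) (λ p → ∑ (perms r) (λ q → g p q)))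
∑-perms-cuts [] g = trans
  (trans (∑-[-] _ _) (∑-[-] _ _))
  (sym (trans (∑-[-] _ _) (trans (∑-[-] _ _) (∑-[-] _ _))))
∑-perms-cuts (x ∷ V) g = begin
  ∑ (perms (x ∷ V)) (λ w → ∑ (cuts w) (λ (p , q) → g p q))
    ≡⟨ ∑-perms-∷ x V _ ⟩
  ∑ (perms V) (λ w → ∑ (cuts w) (λ (p , q) → ∑ (cuts (p ++ x ∷ q)) (λ (p , q) → g p q)))
    ≡⟨ ∑-ext (perms V) (λ w → trans (∑-ext (cuts w) λ (p , q) → ∑-cuts-insert p x q _) (∑-+ (cuts w) _ _)) ⟩
  ∑ (perms V) (λ w →
      ∑ (cuts w) (λ (p , q) → ∑ (cuts p) (λ (p₁ , p₂) → g p₁ (p₂ ++ x ∷ q)))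
    + ∑ (cuts w) (λ (p , q) → ∑ (cuts q) (λ (q₁ , q₂) → g (p ++ x ∷ q₁) q₂)))
    ≡⟨ ∑-+ (perms V) _ _ ⟩
  ∑ (perms V) (λ w → ∑ (cuts w) (λ (p , q) → ∑ (cuts p) (λ (p₁ , p₂) → g p₁ (p₂ ++ x ∷ q))))
    + ∑ (perms V) (λ w → ∑ (cuts w) (λ (p , q) → ∑ (cuts q) (λ (q₁ , q₂) → g (p ++ x ∷ q₁) q₂)))
    ≡⟨ cong₂ _+_
         (∑-ext (perms V) λ w → ∑-cuts-assoc w (λ p₁ p₂ q → g p₁ (p₂ ++ x ∷ q)))
         (∑-ext (perms V) λ w → sym (∑-cuts-assoc w (λ p q₁ q₂ → g (p ++ x ∷ q₁) q₂))) ⟩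
  ∑ (perms V) (λ w → ∑ (cuts w) (λ (p , u) → ∑ (cuts u) (λ (u₁ , u₂) → g p (u₁ ++ x ∷ u₂))))
    + ∑ (perms V) (λ w → ∑ (cuts w) (λ (u , q) → ∑ (cuts u) (λ (u₁ , u₂) → g (u₁ ++ x ∷ u₂) q)))
    ≡⟨ cong₂ _+_ (∑-perms-cuts V _) (∑-perms-cuts V _) ⟩
  ∑ (shares V) (λ (s , r) → ∑ (perms s) (λ p → ∑ (perms r) (λ u → ∑ (cuts u) (λ (u₁ , u₂) → g p (u₁ ++ x ∷ u₂)))))
    + ∑ (shares V) (λ (s , r) → ∑ (perms s) (λ u → ∑ (perms r) (λ q → ∑ (cuts u) (λ (u₁ , u₂) → g (u₁ ++ x ∷ u₂) q))))
    ≡⟨ cong₂ _+_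
         (∑-ext (shares V) λ (s , r) → ∑-ext (perms s) λ p → sym (∑-perms-∷ x r _))
         (∑-ext (shares V) λ (s , r) → trans
           (∑-ext (perms s) λ u → ∑-swap (perms r) (cuts u) _) (sym (∑-perms-∷ x s _))) ⟩
  ∑ (shares V) (λ (s , r) → ∑ (perms s) (λ p → ∑ (perms (x ∷ r)) (λ q → g p q)))
    + ∑ (shares V) (λ (s , r) → ∑ (perms (x ∷ s)) (λ p → ∑ (perms r) (λ q → g p q)))
    ≡⟨ +-comm _ (∑ (shares V) (λ (s , r) → ∑ (perms (x ∷ s)) (λ p → ∑ (perms r) (λ q → g p q)))) ⟩
  ∑ (shares V) (λ (s , r) → ∑ (perms (x ∷ s)) (λ p → ∑ (perms r) (λ q → g p q)))
    + ∑ (shares V) (λ (s , r) → ∑ (perms s) (λ p → ∑ (perms (x ∷ r)) (λ q → g p q)))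
    ≡⟨ sym (∑-shares-∷ x V _) ⟩
  ∑ (shares (x ∷ V)) (λ (s , r) → ∑ (perms s) (λ p → ∑ (perms r) (λ q → g p q))) ∎

∑-shares-comm : (V : List X) (f : List X → List X → ℤ) →
  ∑ (shares V) (λ (s , r) → f s r) ≡ ∑ (shares V) (λ (s , r) → f r s)
∑-shares-comm []      f = trans (∑-[-] _ _) (sym (∑-[-] _ _))
∑-shares-comm (x ∷ V) f = begin
  ∑ (shares (x ∷ V)) (λ (s , r) → f s r)
    ≡⟨ ∑-shares-∷ x V _ ⟩
  ∑ (shares V) (λ (s , r) → f (x ∷ s) r) + ∑ (shares V) (λ (s , r) → f s (x ∷ r))
    ≡⟨ cong₂ _+_ (∑-shares-comm V (f ∘ (x ∷_))) (∑-shares-comm V (λ s r → f s (x ∷ r))) ⟩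
  ∑ (shares V) (λ (s , r) → f (x ∷ r) s) + ∑ (shares V) (λ (s , r) → f r (x ∷ s))
    ≡⟨ +-comm (∑ (shares V) (λ (s , r) → f (x ∷ r) s)) _ ⟩
  ∑ (shares V) (λ (s , r) → f r (x ∷ s)) + ∑ (shares V) (λ (s , r) → f (x ∷ r) s)
    ≡⟨ sym (∑-shares-∷ x V _) ⟩
  ∑ (shares (x ∷ V)) (λ (s , r) → f r s) ∎

∑-shares-assoc : (V : List X) (f : List X → List X → List X → ℤ) →
  ∑ (shares V) (λ (u , r) → ∑ (shares u) (λ (p , q) → f p q r))
    ≡ ∑ (shares V) (λ (p , u) → ∑ (shares u) (λ (q , r) → f p q r))
∑-shares-assoc []      f = trans
  (trans (∑-[-] _ _) (∑-[-] _ _)) (sym (trans (∑-[-] _ _) (∑-[-] _ _)))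
∑-shares-assoc (x ∷ V) f = begin
  ∑ (shares (x ∷ V)) (λ (u , r) → ∑ (shares u) (λ (p , q) → f p q r))
    ≡⟨ ∑-shares-∷ x V _ ⟩
  ∑ (shares V) (λ (u , r) → ∑ (shares (x ∷ u)) (λ (p , q) → f p q r)) + L₃
    ≡⟨ cong (_+ L₃) (trans (∑-ext (shares V) λ (u , r) → ∑-shares-∷ x u _) (∑-+ (shares V) _ _)) ⟩
  (∑ (shares V) (λ (u , r) → ∑ (shares u) (λ (p , q) → f (x ∷ p) q r)) + L₂) + L₃
    ≡⟨ cong₂ _+_ (cong₂ _+_
         (∑-shares-assoc V (λ p q r → f (x ∷ p) q r))
         (∑-shares-assoc V (λ p q r → f p (x ∷ q) r)))
         (∑-shares-assoc V (λ p q r → f p q (x ∷ r))) ⟩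
  (R₁ + R₂) + R₃
    ≡⟨ +-assoc R₁ R₂ R₃ ⟩
  R₁ + (R₂ + R₃)
    ≡⟨ cong (_+_ R₁) (sym (trans (∑-ext (shares V) λ (p , u) → ∑-shares-∷ x u _) (∑-+ (shares V) _ _))) ⟩
  R₁ + ∑ (shares V) (λ (p , u) → ∑ (shares (x ∷ u)) (λ (q , r) → f p q r))
    ≡⟨ sym (∑-shares-∷ x V _) ⟩
  ∑ (shares (x ∷ V)) (λ (p , u) → ∑ (shares u) (λ (q , r) → f p q r)) ∎
  where
  L₂ = ∑ (shares V) (λ (u , r) → ∑ (shares u) (λ (p , q) → f p (x ∷ q) r))
  L₃ = ∑ (shares V) (λ (u , r) → ∑ (shares u) (λ (p , q) → f p q (x ∷ r)))
  R₁ = ∑ (shares V) (λ (p , u) → ∑ (shares u) (λ (q , r) → f (x ∷ p) q r))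
  R₂ = ∑ (shares V) (λ (p , u) → ∑ (shares u) (λ (q , r) → f p (x ∷ q) r))
  R₃ = ∑ (shares V) (λ (p , u) → ∑ (shares u) (λ (q , r) → f p q (x ∷ r)))

∑-shares-exchange : (V : List X) (f : List X → List X → List X → ℤ) →
  ∑ (shares V) (λ (p , u) → ∑ (shares u) (λ (q , r) → f p q r))
    ≡ ∑ (shares V) (λ (q , u) → ∑ (shares u) (λ (p , r) → f p q r))
∑-shares-exchange V f = begin
  ∑ (shares V) (λ (p , u) → ∑ (shares u) (λ (q , r) → f p q r))
    ≡⟨ sym (∑-shares-assoc V f) ⟩
  ∑ (shares V) (λ (u , r) → ∑ (shares u) (λ (p , q) → f p q r))
    ≡⟨ ∑-ext (shares V) (λ (u , r) → ∑-shares-comm u (λ p q → f p q r)) ⟩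
  ∑ (shares V) (λ (u , r) → ∑ (shares u) (λ (q , p) → f p q r))
    ≡⟨ ∑-shares-assoc V (λ q p r → f p q r) ⟩
  ∑ (shares V) (λ (q , u) → ∑ (shares u) (λ (p , r) → f p q r)) ∎

-- Paths through a vertex and cycles through it

-- The value 1 on the empty path lets a cycle through all vertices count with the factor
-- `paths [] = 1`.
pathProduct : (X → X → ℤ) → List X → ℤ
pathProduct g []          = 1ℤ
pathProduct g (x ∷ [])    = 1ℤ
pathProduct g (x ∷ y ∷ w) = g x y * pathProduct g (y ∷ w)

pathProduct-++ : (g : X → X → ℤ) (p : List X) (v : X) (q : List X) →
  pathProduct g (p ++ v ∷ q) ≡ pathProduct g (p ++ [ v ]) * pathProduct g (v ∷ q)
pathProduct-++ g [] v q = sym (*-identityˡ _)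
pathProduct-++ g (x ∷ []) v q = cong (_* pathProduct g (v ∷ q)) (sym (*-identityʳ (g x v)))
pathProduct-++ g (x ∷ y ∷ p) v q =
  trans (cong (g x y *_) (pathProduct-++ g (y ∷ p) v q)) (sym (*-assoc (g x y) _ _))

-- The weights stay abstract because there are two instances: the weights of the digraph, and β = 1
-- with τ = 0, which counts.
module Recursion (β τ : X → X → ℤ) (β≡1+τ : ∀ x y → β x y ≡ 1ℤ + τ x y) where

  paths : List X → ℤ
  paths V = ∑ (perms V) (pathProduct β)

  cycleWeight : X → List X → ℤ
  cycleWeight v c = pathProduct β (v ∷ c ++ [ v ]) - pathProduct τ (v ∷ c ++ [ v ])

  cyclesThrough : X → List X → ℤ
  cyclesThrough v C = ∑ (perms C) (cycleWeight v)

  -- Exchanging β for τ arc by arc from the end costs, at each arc, β - τ = 1: the arc disappears,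
  -- with β before it and τ after it. Fixing the first vertex `x` makes the cuts of `p` correspond
  -- exactly to the arcs.
  telescope : (x : X) (p : List X) (v : X) →
    pathProduct β (x ∷ p ++ [ v ])
      ≡ pathProduct τ (x ∷ p ++ [ v ])
        + ∑ (cuts p) (λ (r , s) → pathProduct β (x ∷ r) * pathProduct τ (s ++ [ v ]))
  telescope x [] v rewrite β≡1+τ x v = trans (lemma (τ x v)) (cong (_+_ (τ x v * 1ℤ)) (sym (∑-[-] _ _)))
    where
    lemma : ∀ t → (1ℤ + t) * 1ℤ ≡ t * 1ℤ + 1ℤ * 1ℤ
    lemma = solve-∀
  telescope x (y ∷ p) v = begin
    β x y * pathProduct β (y ∷ p ++ [ v ])
      ≡⟨ cong₂ _*_ (β≡1+τ x y) (telescope y p v) ⟩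
    (1ℤ + τ x y) * (τ-path + rest)
      ≡⟨ lemma (τ x y) τ-path rest ⟩
    τ x y * τ-path + (1ℤ * τ-path + (1ℤ + τ x y) * rest)
      ≡⟨ cong (λ b → τ x y * τ-path + (1ℤ * τ-path + b * rest)) (sym (β≡1+τ x y)) ⟩
    τ x y * τ-path + (1ℤ * τ-path + β x y * rest)
      ≡⟨ cong (λ s → τ x y * τ-path + (1ℤ * τ-path + s)) (trans
           (∑-*ˡ (β x y) (cuts p) _)
           (∑-ext (cuts p) λ _ → sym (*-assoc (β x y) _ _))) ⟩
    τ x y * τ-path + (1ℤ * τ-path + ∑ (cuts p) (λ (r , s) → pathProduct β (x ∷ y ∷ r) * pathProduct τ (s ++ [ v ])))
      ≡⟨ cong (_+_ (τ x y * τ-path)) (sym (∑-cuts-∷ y p _)) ⟩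
    τ x y * τ-path + ∑ (cuts (y ∷ p)) (λ (r , s) → pathProduct β (x ∷ r) * pathProduct τ (s ++ [ v ])) ∎
    where
    τ-path = pathProduct τ (y ∷ p ++ [ v ])
    rest = ∑ (cuts p) (λ (r , s) → pathProduct β (y ∷ r) * pathProduct τ (s ++ [ v ]))
    lemma : ∀ t p s → (1ℤ + t) * (p + s) ≡ t * p + (1ℤ * p + (1ℤ + t) * s)
    lemma = solve-∀

  -- The pure τ term of `telescope` is the cut with an empty left part, so here the sum absorbs it.
  pathTo : (p : List X) (v : X) → pathProduct β (p ++ [ v ])
    ≡ ∑ (cuts p) (λ (r , s) → pathProduct β r * pathProduct τ (s ++ [ v ]))
  pathTo []      v = sym (∑-[-] _ _)
  pathTo (x ∷ p) v = trans (telescope x p v) (trans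
    (cong (_+ ∑ (cuts p) (λ (r , s) → pathProduct β (x ∷ r) * pathProduct τ (s ++ [ v ])))
      (sym (*-identityˡ (pathProduct τ (x ∷ p ++ [ v ]))))) (sym (∑-cuts-∷ x p _)))

  -- The same telescoping around a closed walk. Subtracting the pure τ product leaves the terms in
  -- which one arc has been removed.
  cycleWeight-cuts : (v : X) (c : List X) → cycleWeight v c
    ≡ ∑ (cuts c) (λ (q , s) → pathProduct β (v ∷ q) * pathProduct τ (s ++ [ v ]))
  cycleWeight-cuts v c = trans
    (cong (_- pathProduct τ (v ∷ c ++ [ v ])) (telescope v c v))
    (lemma (pathProduct τ (v ∷ c ++ [ v ])) _)
    where
    lemma : ∀ t s → (t + s) - t ≡ s
    lemma = solve-∀

  -- Expanding the path before `v` leaves a free β-path `a`, a τ-path through `b` into `v`, and a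
  -- β-path from `v` through `r`. By `cycleWeight-cuts` the last two are a cycle through `v` with
  -- the arc from the end of `r` to the start of `b` removed.
  paths-∷ : (v : X) (V : List X) →
    paths (v ∷ V) ≡ ∑ (shares V) (λ (C , R) → cyclesThrough v C * paths R)
  paths-∷ v V = begin
    paths (v ∷ V)
      ≡⟨ ∑-perms-∷ v V _ ⟩
    ∑ (perms V) (λ w → ∑ (cuts w) (λ (p , q) → pathProduct β (p ++ v ∷ q)))
      ≡⟨ ∑-perms-cuts V _ ⟩
    ∑ (shares V) (λ (s , r) → ∑ (perms s) (λ p → ∑ (perms r) (λ q → pathProduct β (p ++ v ∷ q))))
      ≡⟨ ∑-ext (shares V) (λ (s , r) → trans
           (∑-ext (perms s) λ p → ∑-ext (perms r) λ q → pathProduct-++ β p v q)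
           (∑-product (perms s) (perms r) _ _)) ⟩
    ∑ (shares V) (λ (s , r) → ∑ (perms s) (λ p → pathProduct β (p ++ [ v ])) * from r)
      ≡⟨ ∑-ext (shares V) (λ (s , r) → cong (_* from r) (trans
           (∑-ext (perms s) λ p → pathTo p v) (split s (pathProduct β) _))) ⟩
    ∑ (shares V) (λ (s , r) → ∑ (shares s) (λ (a , b) → paths a * into b) * from r)
      ≡⟨ ∑-ext (shares V) (λ (s , r) → ∑-*ʳ (from r) (shares s) _) ⟩
    ∑ (shares V) (λ (s , r) → ∑ (shares s) (λ (a , b) → paths a * into b * from r))
      ≡⟨ ∑-shares-assoc V (λ a b r → paths a * into b * from r) ⟩
    ∑ (shares V) (λ (a , u) → ∑ (shares u) (λ (b , r) → paths a * into b * from r))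
      -- The free path `a` becomes the rest `R`, while `r` and `b`, in this order after `v`, fill
      -- the cycle.
      ≡⟨ ∑-shares-comm V (λ a u → ∑ (shares u) (λ (b , r) → paths a * into b * from r)) ⟩
    ∑ (shares V) (λ (u , a) → ∑ (shares u) (λ (b , r) → paths a * into b * from r))
      ≡⟨ ∑-ext (shares V) (λ (u , a) → trans (∑-shares-comm u (λ b r → paths a * into b * from r))
           (∑-ext (shares u) λ (r , b) → lemma (paths a) (into b) (from r))) ⟩
    ∑ (shares V) (λ (u , a) → ∑ (shares u) (λ (r , b) → from r * into b * paths a))
      ≡⟨ ∑-ext (shares V) (λ (u , a) → sym (∑-*ʳ (paths a) (shares u) _)) ⟩
    ∑ (shares V) (λ (u , a) → ∑ (shares u) (λ (r , b) → from r * into b) * paths a)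
      ≡⟨ ∑-ext (shares V) (λ (u , a) → cong (_* paths a) (sym (trans
           (∑-ext (perms u) (cycleWeight-cuts v)) (split u (λ q → pathProduct β (v ∷ q)) _)))) ⟩
    ∑ (shares V) (λ (C , R) → cyclesThrough v C * paths R) ∎
    where
    from into : List X → ℤ
    from r = ∑ (perms r) (λ q → pathProduct β (v ∷ q))
    into b = ∑ (perms b) (λ s → pathProduct τ (s ++ [ v ]))
    split : (s : List X) (f g : List X → ℤ) →
      ∑ (perms s) (λ w → ∑ (cuts w) (λ (p , q) → f p * g q)) ≡ ∑ (shares s) (λ (a , b) → ∑ (perms a) f * ∑ (perms b) g)
    split s f g = trans (∑-perms-cuts s _) (∑-ext (shares s) λ (a , b) → ∑-product (perms a) (perms b) f g)
    lemma : ∀ a b c → a * b * c ≡ c * b * a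
    lemma = solve-∀

-- Enumerations: membership and absence of repetition

∈-cuts⁻ : (w : List X) {p q : List X} → (p , q) ∈ cuts w → p ++ q ≡ w
∈-cuts⁻ []      (here refl) = refl
∈-cuts⁻ (x ∷ w) (here refl) = refl
∈-cuts⁻ (x ∷ w) (there i) with ∈-map⁻ _ i
... | _ , j , refl = cong (x ∷_) (∈-cuts⁻ w j)

∈-cuts⁺ : (p q : List X) → (p , q) ∈ cuts (p ++ q)
∈-cuts⁺ []      []      = here refl
∈-cuts⁺ []      (x ∷ q) = here refl
∈-cuts⁺ (x ∷ p) q       = there (∈-map⁺ _ (∈-cuts⁺ p q))

∈-shares⁻ : (V : List X) {s r : List X} → (s , r) ∈ shares V → s ++ r ↭ V
∈-shares⁻ []      (here refl) = ↭.refl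
∈-shares⁻ (x ∷ V) i with ∈-++⁻ (map (map₁ (x ∷_)) (shares V)) i
... | inj₁ j with ∈-map⁻ _ j
...   | _ , k , refl = ↭.prep x (∈-shares⁻ V k)
∈-shares⁻ (x ∷ V) i | inj₂ j with ∈-map⁻ _ j
...   | (s , r) , k , refl = ↭-trans (shift x s r) (↭.prep x (∈-shares⁻ V k))

∈-shares-length : (V : List X) {s r : List X} → (s , r) ∈ shares V → length V ≡ length s ℕ.+ length r
∈-shares-length V {s} i = trans (sym (↭-length (∈-shares⁻ V i))) (length-++ s)

∈-perms-∷⁻ : (x : X) (V : List X) {w : List X} → w ∈ perms (x ∷ V) →
  Σ (List X × List X) λ (p , q) → (p ++ q) ∈ perms V × w ≡ p ++ x ∷ q
∈-perms-∷⁻ x V i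
  with u , u∈ , j ← find (∈-concatMap⁻ _ {xs = perms V} i)
  with (p , q) , pq∈ , refl ← ∈-map⁻ _ j
  = (p , q) , subst (_∈ perms V) (sym (∈-cuts⁻ u pq∈)) u∈ , refl

∈-perms⁻ : (V : List X) {w : List X} → w ∈ perms V → w ↭ V
∈-perms⁻ []      (here refl) = ↭.refl
∈-perms⁻ (x ∷ V) i with (p , q) , j , refl ← ∈-perms-∷⁻ x V i =
  ↭-trans (shift x p q) (↭.prep x (∈-perms⁻ V j))

∈-perms⁺ : (V : List X) {w : List X} → w ↭ V → w ∈ perms V
∈-perms⁺ []      e with refl ← ↭-empty-inv e = here refl
∈-perms⁺ (x ∷ V) e with p , q , refl ← ∈-∃++ (∈-resp-↭ (↭-sym e) (here refl)) =
  ∈-concatMap⁺ _ (lose (∈-perms⁺ V (drop-mid p [] e)) (∈-map⁺ _ (∈-cuts⁺ p q)))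

concatMap-unique : (f : X → List Y) {xs : List X} → Unique xs →
  (∀ {x} → x ∈ xs → Unique (f x)) →
  (∀ {x y z} → x ∈ xs → y ∈ xs → z ∈ f x → z ∈ f y → x ≡ y) →
  Unique (concatMap f xs)
concatMap-unique f []       u d = []
concatMap-unique f (x∉ ∷ p) u d = Uniqueₚ.++⁺ (u (here refl))
  (concatMap-unique f p (u ∘ there) (λ i j → d (there i) (there j)))
  (λ (i , j) → let (y , y∈ , k) = find (∈-concatMap⁻ f j) in
    All.lookup x∉ y∈ (d (here refl) (there y∈) i k))

map-unique : (f : X → Y) {xs : List X} → Unique xs →
  (∀ {x y} → x ∈ xs → y ∈ xs → f x ≡ f y → x ≡ y) → Unique (map f xs)
map-unique f []       d = []
map-unique f (x∉ ∷ p) d =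
  All.tabulate (λ i e → let (y , y∈ , e′) = ∈-map⁻ f i in
    All.lookup x∉ y∈ (d (here refl) (there y∈) (trans e e′)))
  ∷ map-unique f p (λ i j → d (there i) (there j))

cuts-unique : (w : List X) → Unique (cuts w)
cuts-unique []      = All.[] ∷ []
cuts-unique (x ∷ w) =
  All.tabulate (λ i e → absurd (∈-map⁻ _ i) e)
  ∷ Uniqueₚ.map⁺ (λ { refl → refl }) (cuts-unique w)
  where
  absurd : {d : List _ × List _} → (Σ _ λ y → y ∈ cuts w × d ≡ map₁ (x ∷_) y) → ([] , x ∷ w) ≡ d → ⊥
  absurd (_ , _ , refl) ()

-- Since neither prefix contains `x`, its first occurrence marks the place of insertion on both
-- sides.
insert-injective : (x : X) (p p′ : List X) {q q′ : List X} → x ∉ p → x ∉ p′ →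
  p ++ x ∷ q ≡ p′ ++ x ∷ q′ → (p , q) ≡ (p′ , q′)
insert-injective x []      []       _ _ refl = refl
insert-injective x []      (y ∷ p′) _ n refl = ⊥-elim (n (here refl))
insert-injective x (y ∷ p) []       n _ refl = ⊥-elim (n (here refl))
insert-injective x (y ∷ p) (z ∷ p′) m n e
  with refl ← ∷-injectiveˡ e
  with refl ← insert-injective x p p′ (m ∘ there) (n ∘ there) (∷-injectiveʳ e) = refl

perms-unique : {V : List X} → Unique V → Unique (perms V)
perms-unique {V = []}    []       = All.[] ∷ []
perms-unique {V = x ∷ V} (x∉ ∷ p) = concatMap-unique _ (perms-unique p)
  (λ {w} w∈ → map-unique _ (cuts-unique w) λ {(a , b)} {(c , d)} i j →
    insert-injective x a c (fresh w∈ i) (fresh w∈ j))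
  same
  where
  fresh : ∀ {w a b} → w ∈ perms V → (a , b) ∈ cuts w → x ∉ a
  fresh {w} w∈ i x∈a = All.lookup x∉
    (∈-resp-↭ (∈-perms⁻ V w∈) (subst (x ∈_) (∈-cuts⁻ w i) (∈-++⁺ˡ x∈a))) refl
  same : ∀ {w w′ z} → w ∈ perms V → w′ ∈ perms V →
    z ∈ map (λ (p , q) → p ++ x ∷ q) (cuts w) → z ∈ map (λ (p , q) → p ++ x ∷ q) (cuts w′) → w ≡ w′
  same {w} {w′} w∈ w′∈ i j
    with (a , b) , k , refl ← ∈-map⁻ _ i
    with (c , d) , l , e ← ∈-map⁻ _ j
    with refl ← insert-injective x a c (fresh w∈ k) (fresh w′∈ l) e
    = trans (sym (∈-cuts⁻ w k)) (∈-cuts⁻ w′ l)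

-- Multiplication by power sums

⟦_⟧ : Bool → ℤ
⟦ b ⟧ = if b then 1ℤ else 0ℤ

⟦∧⟧ : ∀ a b → ⟦ a ∧ b ⟧ ≡ ⟦ a ⟧ * ⟦ b ⟧
⟦∧⟧ true  b = sym (*-identityˡ ⟦ b ⟧)
⟦∧⟧ false b = refl

-- The product p_k ψ: the variable chosen in p_k is either the first one or a later one.
powerSumTimes : ℕ → (List ℕ → ℤ) → List ℕ → ℤ
powerSumTimes k ψ []      = 0ℤ
powerSumTimes k ψ (a ∷ α) =
  ⟦ k <ᵇ suc a ⟧ * ψ (a ∸ k ∷ α) + powerSumTimes k (ψ ∘ (a ∷_)) α

powerSumTimes-ext : (k : ℕ) {ψ φ : List ℕ → ℤ} → (∀ α → ψ α ≡ φ α) →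
  ∀ α → powerSumTimes k ψ α ≡ powerSumTimes k φ α
powerSumTimes-ext k e []      = refl
powerSumTimes-ext k e (a ∷ α) =
  cong₂ _+_ (cong (⟦ k <ᵇ suc a ⟧ *_) (e _)) (powerSumTimes-ext k (e ∘ (a ∷_)) α)

*-exchange : ∀ a b c → a * (b * c) ≡ b * (a * c)
*-exchange = solve-∀

powerSumTimes-∑ : (k : ℕ) (xs : List X) (c : X → ℤ) (ψ : X → List ℕ → ℤ) → ∀ α →
  powerSumTimes k (λ γ → ∑ xs (λ x → c x * ψ x γ)) α ≡ ∑ xs (λ x → c x * powerSumTimes k (ψ x) α)
powerSumTimes-∑ k xs c ψ [] = sym (trans (∑-ext xs λ x → *-zeroʳ (c x)) (∑-zero xs))
powerSumTimes-∑ k xs c ψ (a ∷ α) = begin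
  i * ∑ xs (λ x → c x * ψ x (a ∸ k ∷ α)) + powerSumTimes k (λ γ → ∑ xs (λ x → c x * ψ x (a ∷ γ))) α
    ≡⟨ cong₂ _+_ (trans (∑-*ˡ i xs _) (∑-ext xs λ x → *-exchange i (c x) _)) (powerSumTimes-∑ k xs c _ α) ⟩
  ∑ xs (λ x → c x * (i * ψ x (a ∸ k ∷ α))) + ∑ xs (λ x → c x * powerSumTimes k (ψ x ∘ (a ∷_)) α)
    ≡⟨ sym (∑-+ xs _ _) ⟩
  ∑ xs (λ x → c x * (i * ψ x (a ∸ k ∷ α)) + c x * powerSumTimes k (ψ x ∘ (a ∷_)) α)
    ≡⟨ ∑-ext xs (λ x → sym (*-distribˡ-+ (c x) _ _)) ⟩
  ∑ xs (λ x → c x * powerSumTimes k (ψ x) (a ∷ α)) ∎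
  where i = ⟦ k <ᵇ suc a ⟧

∑-upTo-suc : (n : ℕ) (h : ℕ → ℤ) → ∑ (upTo (suc n)) h ≡ h 0 + ∑ (upTo n) (h ∘ suc)
∑-upTo-suc n h = trans (∑-∷ 0 _ h) (cong (_+_ (h 0)) (trans
  (cong (λ l → ∑ l h) (sym (map-upTo suc n)))
  (∑-map suc (upTo n) h)))

∑-upTo-≡ᵇ : (k n : ℕ) (h : ℕ → ℤ) → ∑ (upTo n) (λ b → ⟦ b ≡ᵇ k ⟧ * h b) ≡ ⟦ k <ᵇ n ⟧ * h k
∑-upTo-≡ᵇ k       zero    h = ∑-[] _
∑-upTo-≡ᵇ zero    (suc n) h = trans (∑-upTo-suc n _) (trans
  (cong (_+_ (1ℤ * h 0)) (trans (∑-ext (upTo n) λ b → *-zeroˡ (h (suc b))) (∑-zero (upTo n)))) (+-identityʳ _))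
∑-upTo-≡ᵇ (suc k) (suc n) h = trans (∑-upTo-suc n _) (trans (+-identityˡ _) (∑-upTo-≡ᵇ k n (h ∘ suc)))

∑-splits-∷ : (a : ℕ) (α : List ℕ) (f : List ℕ × List ℕ → ℤ) →
  ∑ (splits (a ∷ α)) f ≡ ∑ (upTo (suc a)) (λ b → ∑ (splits α) (λ (β , γ) → f (b ∷ β , a ∸ b ∷ γ)))
∑-splits-∷ a α f = trans (∑-concatMap _ (upTo (suc a)) f) (∑-ext (upTo (suc a)) λ b → ∑-map _ (splits α) f)

+oneS : ∀ a α → + oneS (a ∷ α) ≡ ⟦ a ≡ᵇ 0 ⟧ * + oneS α
+oneS zero    α = sym (*-identityˡ _)
+oneS (suc a) α = refl

+if : ∀ b n → + (if b then n else 0) ≡ ⟦ b ⟧ * + n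
+if true  n = sym (*-identityˡ _)
+if false n = refl

oneS⊗ : (ψ : List ℕ → ℤ) (α : List ℕ) → ∑ (splits α) (λ (β , γ) → + oneS β * ψ γ) ≡ ψ α
oneS⊗ ψ []      = trans (∑-[-] _ _) (*-identityˡ _)
oneS⊗ ψ (a ∷ α) = begin
  ∑ (splits (a ∷ α)) (λ (β , γ) → + oneS β * ψ γ)
    ≡⟨ ∑-splits-∷ a α _ ⟩
  ∑ (upTo (suc a)) (λ b → ∑ (splits α) (λ (β , γ) → + oneS (b ∷ β) * ψ (a ∸ b ∷ γ)))
    ≡⟨ ∑-ext (upTo (suc a)) (λ b → trans
         (∑-ext (splits α) λ (β , γ) → trans (cong (_* ψ (a ∸ b ∷ γ)) (+oneS b β)) (*-assoc ⟦ b ≡ᵇ 0 ⟧ _ _))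
         (trans (sym (∑-*ˡ ⟦ b ≡ᵇ 0 ⟧ (splits α) _)) (cong (⟦ b ≡ᵇ 0 ⟧ *_) (oneS⊗ (ψ ∘ (a ∸ b ∷_)) α)))) ⟩
  ∑ (upTo (suc a)) (λ b → ⟦ b ≡ᵇ 0 ⟧ * ψ (a ∸ b ∷ α))
    ≡⟨ ∑-upTo-≡ᵇ 0 (suc a) _ ⟩
  1ℤ * ψ (a ∷ α)
    ≡⟨ *-identityˡ _ ⟩
  ψ (a ∷ α) ∎

-- Of the ways to split the first exponent only two survive: `b = k`, where the power sum takes the
-- first variable and nothing else, and `b = 0`, where it takes a later one. They are the two
-- summands of `powerSumTimes`.
powerSum⊗ : (k : ℕ) (ψ : List ℕ → ℤ) (α : List ℕ) →
  ∑ (splits α) (λ (β , γ) → + powerSum k β * ψ γ) ≡ powerSumTimes k ψ α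
powerSum⊗ k ψ []      = ∑-[-] _ _
powerSum⊗ k ψ (a ∷ α) = begin
  ∑ (splits (a ∷ α)) (λ (β , γ) → + powerSum k β * ψ γ)
    ≡⟨ ∑-splits-∷ a α _ ⟩
  ∑ (upTo (suc a)) (λ b → ∑ (splits α) (λ (β , γ) → + powerSum k (b ∷ β) * ψ (a ∸ b ∷ γ)))
    ≡⟨ ∑-ext (upTo (suc a)) (λ b → trans (∑-ext (splits α) λ (β , γ) → head-split b β γ) (trans (∑-+ (splits α) _ _)
         (cong₂ _+_
           (trans (sym (∑-*ˡ ⟦ b ≡ᵇ k ⟧ (splits α) _)) (cong (⟦ b ≡ᵇ k ⟧ *_) (oneS⊗ (ψ ∘ (a ∸ b ∷_)) α)))
           (trans (sym (∑-*ˡ ⟦ b ≡ᵇ 0 ⟧ (splits α) _)) (cong (⟦ b ≡ᵇ 0 ⟧ *_) (powerSum⊗ k (ψ ∘ (a ∸ b ∷_)) α)))))) ⟩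
  ∑ (upTo (suc a)) (λ b → ⟦ b ≡ᵇ k ⟧ * ψ (a ∸ b ∷ α) + ⟦ b ≡ᵇ 0 ⟧ * powerSumTimes k (ψ ∘ (a ∸ b ∷_)) α)
    ≡⟨ ∑-+ (upTo (suc a)) _ _ ⟩
  ∑ (upTo (suc a)) (λ b → ⟦ b ≡ᵇ k ⟧ * ψ (a ∸ b ∷ α))
    + ∑ (upTo (suc a)) (λ b → ⟦ b ≡ᵇ 0 ⟧ * powerSumTimes k (ψ ∘ (a ∸ b ∷_)) α)
    ≡⟨ cong₂ _+_ (∑-upTo-≡ᵇ k (suc a) _) (trans (∑-upTo-≡ᵇ 0 (suc a) _) (*-identityˡ _)) ⟩
  powerSumTimes k ψ (a ∷ α) ∎
  where
  lemma : ∀ i j x y z → (i * x + j * y) * z ≡ i * (x * z) + j * (y * z)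
  lemma = solve-∀
  head-split : ∀ b β γ → + powerSum k (b ∷ β) * ψ (a ∸ b ∷ γ)
    ≡ ⟦ b ≡ᵇ k ⟧ * (+ oneS β * ψ (a ∸ b ∷ γ)) + ⟦ b ≡ᵇ 0 ⟧ * (+ powerSum k β * ψ (a ∸ b ∷ γ))
  head-split b β γ = trans
    (cong (_* ψ (a ∸ b ∷ γ)) (trans (pos-+ (if b ≡ᵇ k then oneS β else 0) _)
      (cong₂ _+_ (+if (b ≡ᵇ k) (oneS β)) (+if (b ≡ᵇ 0) (powerSum k β)))))
    (lemma ⟦ b ≡ᵇ k ⟧ ⟦ b ≡ᵇ 0 ⟧ (+ oneS β) (+ powerSum k β) (ψ (a ∸ b ∷ γ)))

+sum-map : (f : X → ℕ) (xs : List X) → + sum (map f xs) ≡ ∑ xs (λ x → + f x)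
+sum-map f []       = sym (∑-[] _)
+sum-map f (x ∷ xs) = trans (pos-+ (f x) _) (trans (cong (_+_ (+ f x)) (+sum-map f xs)) (sym (∑-∷ x xs _)))

+powerSum⊗ : (k : ℕ) (s : List ℕ → ℕ) (α : List ℕ) → + (powerSum k ⊗ s) α ≡ powerSumTimes k (λ γ → + s γ) α
+powerSum⊗ k s α = trans (+sum-map _ (splits α))
  (trans (∑-ext (splits α) λ (β , γ) → pos-* (powerSum k β) (s γ)) (powerSum⊗ k _ α))

-- The guard says that k is at most a, which rules out truncation in `a ∸ k`.
⟦<⟧*⟦≡∸⟧ : ∀ k m a → ⟦ k <ᵇ suc a ⟧ * ⟦ m ≡ᵇ a ∸ k ⟧ ≡ ⟦ k ℕ.+ m ≡ᵇ a ⟧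
⟦<⟧*⟦≡∸⟧ zero    m a       = *-identityˡ _
⟦<⟧*⟦≡∸⟧ (suc k) m zero    = refl
⟦<⟧*⟦≡∸⟧ (suc k) m (suc a) = ⟦<⟧*⟦≡∸⟧ k m a

-- The cycle recursion in several variables

module SeriesRecursion (β τ : X → X → ℤ) (β≡1+τ : ∀ x y → β x y ≡ 1ℤ + τ x y) where
  open Recursion β τ β≡1+τ

  blockWeight : List X → List ℕ → ℤ
  blockWeight w []      = ⟦ 0 ≡ᵇ length w ⟧
  blockWeight w (a ∷ α) =
    ∑ (cuts w) (λ (p , q) → ⟦ length p ≡ᵇ a ⟧ * pathProduct β p * blockWeight q α)

  blockSeries : List X → List ℕ → ℤ
  blockSeries V α = ∑ (perms V) (λ w → blockWeight w α)

  blockSeries-∷ : (V : List X) (a : ℕ) (α : List ℕ) → blockSeries V (a ∷ α)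
    ≡ ∑ (shares V) (λ (S , R) → ⟦ length S ≡ᵇ a ⟧ * paths S * blockSeries R α)
  blockSeries-∷ V a α = trans (∑-perms-cuts V _) (∑-ext (shares V) λ (S , R) → trans
    (∑-product (perms S) (perms R) (λ p → ⟦ length p ≡ᵇ a ⟧ * pathProduct β p) (λ q → blockWeight q α))
    (cong (_* blockSeries R α) (trans
      (∑-cong (perms S) λ {p} p∈ → cong (λ l → ⟦ l ≡ᵇ a ⟧ * pathProduct β p) (↭-length (∈-perms⁻ S p∈)))
      (sym (∑-*ˡ ⟦ length S ≡ᵇ a ⟧ (perms S) _)))))

  -- Induction on the variables. If `v` lies in the first block, `paths-∷` splits off its cycle
  -- there; if it lies in a later block, the induction hypothesis applies to what the first block
  -- leaves. These two cases are the two summands of `powerSumTimes`.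
  cycleExpansion : (v : X) (V : List X) (α : List ℕ) → blockSeries (v ∷ V) α
    ≡ ∑ (shares V) (λ (C , R) → cyclesThrough v C * powerSumTimes (suc (length C)) (blockSeries R) α)
  cycleExpansion v V [] = trans
    (trans (∑-cong (perms (v ∷ V)) λ {w} w∈ → cong (λ l → ⟦ 0 ≡ᵇ l ⟧) (↭-length (∈-perms⁻ (v ∷ V) w∈)))
      (∑-zero (perms (v ∷ V))))
    (sym (trans (∑-ext (shares V) λ (C , R) → *-zeroʳ (cyclesThrough v C)) (∑-zero (shares V))))
  cycleExpansion v V (a ∷ α) = begin
    blockSeries (v ∷ V) (a ∷ α)
      ≡⟨ trans (blockSeries-∷ (v ∷ V) a α) (∑-shares-∷ v V _) ⟩
    ∑ (shares V) (λ (S , R) → ⟦ suc (length S) ≡ᵇ a ⟧ * paths (v ∷ S) * blockSeries R α)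
      + ∑ (shares V) (λ (S , R) → ⟦ length S ≡ᵇ a ⟧ * paths S * blockSeries (v ∷ R) α)
      ≡⟨ cong₂ _+_ first second ⟩
    ∑ (shares V) (λ (C , R) → G C * (⟦ length C <ᵇ a ⟧ * blockSeries R (a ∸ suc (length C) ∷ α)))
      + ∑ (shares V) (λ (C , R) → G C * powerSumTimes (suc (length C)) (blockSeries R ∘ (a ∷_)) α)
      ≡⟨ sym (∑-+ (shares V) _ _) ⟩
    ∑ (shares V) (λ (C , R) → G C * (⟦ length C <ᵇ a ⟧ * blockSeries R (a ∸ suc (length C) ∷ α))
      + G C * powerSumTimes (suc (length C)) (blockSeries R ∘ (a ∷_)) α)
      ≡⟨ ∑-ext (shares V) (λ (C , R) → sym (*-distribˡ-+ (G C) _ _)) ⟩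
    ∑ (shares V) (λ (C , R) → G C * powerSumTimes (suc (length C)) (blockSeries R) (a ∷ α)) ∎
    where
    G : List X → ℤ
    G = cyclesThrough v

    term₁ : List X → List X → List X → ℤ
    term₁ C S R = ⟦ suc (length C) ℕ.+ length S ≡ᵇ a ⟧ * (G C * paths S) * blockSeries R α

    arrange₁ : ∀ g i j h b → g * (i * (j * h * b)) ≡ (i * j) * (g * h) * b
    arrange₁ = solve-∀

    first : ∑ (shares V) (λ (S , R) → ⟦ suc (length S) ≡ᵇ a ⟧ * paths (v ∷ S) * blockSeries R α)
      ≡ ∑ (shares V) (λ (C , R) → G C * (⟦ length C <ᵇ a ⟧ * blockSeries R (a ∸ suc (length C) ∷ α)))
    first = begin
      ∑ (shares V) (λ (S , R) → ⟦ suc (length S) ≡ᵇ a ⟧ * paths (v ∷ S) * blockSeries R α)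
        ≡⟨ ∑-ext (shares V) (λ (S , R) → trans
             (cong (_* blockSeries R α) (trans
               (cong (⟦ suc (length S) ≡ᵇ a ⟧ *_) (paths-∷ v S))
               (∑-*ˡ ⟦ suc (length S) ≡ᵇ a ⟧ (shares S) _)))
             (trans (∑-*ʳ (blockSeries R α) (shares S) _)
               (∑-cong (shares S) λ {(C , T)} i →
                 cong (λ l → ⟦ suc l ≡ᵇ a ⟧ * (G C * paths T) * blockSeries R α) (∈-shares-length S i)))) ⟩
      ∑ (shares V) (λ (S , R) → ∑ (shares S) (λ (C , T) → term₁ C T R))
        -- The first block consists of the cycle `v ∷ C` and of `S`. Regrouped, `S` is the first
        -- block of `R`, whose size is `a` less the length of the cycle.
        ≡⟨ ∑-shares-assoc V term₁ ⟩
      ∑ (shares V) (λ (C , R) → ∑ (shares R) (λ (S , T) → term₁ C S T))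
        ≡⟨ ∑-ext (shares V) (λ (C , R) → sym (trans
             (cong (λ s → G C * (⟦ length C <ᵇ a ⟧ * s)) (blockSeries-∷ R (a ∸ suc (length C)) α))
             (trans (cong (G C *_) (∑-*ˡ ⟦ length C <ᵇ a ⟧ (shares R) _)) (trans (∑-*ˡ (G C) (shares R) _)
               (∑-ext (shares R) λ (S , T) → trans
                 (arrange₁ (G C) ⟦ length C <ᵇ a ⟧ ⟦ length S ≡ᵇ a ∸ suc (length C) ⟧ (paths S) (blockSeries T α))
                 (cong (λ i → i * (G C * paths S) * blockSeries T α) (⟦<⟧*⟦≡∸⟧ (suc (length C)) (length S) a))))))) ⟩
      ∑ (shares V) (λ (C , R) → G C * (⟦ length C <ᵇ a ⟧ * blockSeries R (a ∸ suc (length C) ∷ α))) ∎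

    term₂ : List X → List X → List X → ℤ
    term₂ S C R = ⟦ length S ≡ᵇ a ⟧ * paths S * (G C * powerSumTimes (suc (length C)) (blockSeries R) α)

    second : ∑ (shares V) (λ (S , R) → ⟦ length S ≡ᵇ a ⟧ * paths S * blockSeries (v ∷ R) α)
      ≡ ∑ (shares V) (λ (C , R) → G C * powerSumTimes (suc (length C)) (blockSeries R ∘ (a ∷_)) α)
    second = begin
      ∑ (shares V) (λ (S , R) → ⟦ length S ≡ᵇ a ⟧ * paths S * blockSeries (v ∷ R) α)
        ≡⟨ ∑-ext (shares V) (λ (S , R) → trans
             (cong (⟦ length S ≡ᵇ a ⟧ * paths S *_) (cycleExpansion v R α))
             (∑-*ˡ (⟦ length S ≡ᵇ a ⟧ * paths S) (shares R) _)) ⟩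
      ∑ (shares V) (λ (S , R) → ∑ (shares R) (λ (C , T) → term₂ S C T))
        -- The first block `S` was chosen before the cycle; the exchange makes the choice of `C` the
        -- outer one.
        ≡⟨ ∑-shares-exchange V term₂ ⟩
      ∑ (shares V) (λ (C , R) → ∑ (shares R) (λ (S , T) → term₂ S C T))
        ≡⟨ ∑-ext (shares V) (λ (C , R) → sym (trans
             (cong (G C *_) (trans
               (powerSumTimes-ext (suc (length C)) (λ γ → blockSeries-∷ R a γ) α)
               (powerSumTimes-∑ (suc (length C)) (shares R)
                 (λ (S , T) → ⟦ length S ≡ᵇ a ⟧ * paths S) (λ (S , T) → blockSeries T) α)))
             (trans (∑-*ˡ (G C) (shares R) _)
               (∑-ext (shares R) λ (S , T) → *-exchange (G C) (⟦ length S ≡ᵇ a ⟧ * paths S) _)))) ⟩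
      ∑ (shares V) (λ (C , R) → G C * powerSumTimes (suc (length C)) (blockSeries R ∘ (a ∷_)) α) ∎

-- Lists without repetition

Unique-resp-↭ : {xs ys : List X} → xs ↭ ys → Unique xs → Unique ys
Unique-resp-↭ p = ↭ₛ.Unique-resp-↭ (setoid _) (↭.↭⇒↭ₛ p)

unique-++⁻ˡ : (xs : List X) {ys : List X} → Unique (xs ++ ys) → Unique xs
unique-++⁻ˡ []       u        = []
unique-++⁻ˡ (x ∷ xs) (x∉ ∷ u) = Allₚ.++⁻ˡ xs x∉ ∷ unique-++⁻ˡ xs u

unique-++⁻ʳ : (xs : List X) {ys : List X} → Unique (xs ++ ys) → Unique ys
unique-++⁻ʳ []       u       = u
unique-++⁻ʳ (x ∷ xs) (_ ∷ u) = unique-++⁻ʳ xs u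

⊆-remove : {x : X} (p : List X) {q xs : List X} → All (x ≢_) xs →
  (∀ {y} → y ∈ xs → y ∈ p ++ x ∷ q) → ∀ {y} → y ∈ xs → y ∈ p ++ q
⊆-remove p x∉ sub i with ∈-++⁻ p (sub i)
... | inj₁ j          = ∈-++⁺ˡ j
... | inj₂ (here refl) = ⊥-elim (All.lookup x∉ i refl)
... | inj₂ (there j)  = ∈-++⁺ʳ p j

length-insert : (p : List X) {x : X} {q : List X} → length (p ++ x ∷ q) ≡ suc (length (p ++ q))
length-insert p {x} {q} = ↭-length (shift x p q)

unique-⊆⇒length≤ : {xs ys : List X} → Unique xs → (∀ {x} → x ∈ xs → x ∈ ys) → length xs ≤ length ys
unique-⊆⇒length≤ []       sub = z≤n
unique-⊆⇒length≤ (x∉ ∷ u) sub with p , q , refl ← ∈-∃++ (sub (here refl)) =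
  subst (suc _ ≤_) (sym (length-insert p)) (s≤s (unique-⊆⇒length≤ u (⊆-remove p x∉ (sub ∘ there))))

-- The pigeonhole principle: each entry of `xs` uses up its own place in `ys`, and the bound on
-- lengths leaves no place over. An injection and a count thereby replace a proof of surjectivity.
unique-⊆⇒↭ : {xs ys : List X} → Unique xs → (∀ {x} → x ∈ xs → x ∈ ys) → length ys ≤ length xs → xs ↭ ys
unique-⊆⇒↭ {ys = []} []       sub l = ↭.refl
unique-⊆⇒↭ (x∉ ∷ u) sub l with p , q , refl ← ∈-∃++ (sub (here refl)) =
  ↭-trans (↭-prep _ (unique-⊆⇒↭ u (⊆-remove p x∉ (sub ∘ there)) (ℕ.s≤s⁻¹ (subst (_≤ _) (length-insert p) l))))
    (↭-sym (shift _ p q))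

unique-set⇒↭ : {xs ys : List X} → Unique xs → Unique ys →
  (∀ {x} → x ∈ xs → x ∈ ys) → (∀ {x} → x ∈ ys → x ∈ xs) → xs ↭ ys
unique-set⇒↭ u v sub sup = unique-⊆⇒↭ u sub (unique-⊆⇒length≤ v sup)

∑-perms-reverse : {C : List X} → Unique C → (h : List X → ℤ) → ∑ (perms C) (h ∘ reverse) ≡ ∑ (perms C) h
∑-perms-reverse {C = C} u h = trans (sym (∑-map reverse (perms C) h)) (∑-↭ h
  (unique-⊆⇒↭ (Uniqueₚ.map⁺ reverse-injective (perms-unique u)) sub
    (ℕₚ.≤-reflexive (sym (length-map reverse (perms C))))))
  where
  sub : ∀ {w} → w ∈ map reverse (perms C) → w ∈ perms C
  sub i with w , j , refl ← ∈-map⁻ reverse i = ∈-perms⁺ C (↭-trans (↭-reverse w) (∈-perms⁻ C j))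

-- Decompositions into cycles and their number

∑-one : (xs : List X) → ∑ xs (λ _ → 1ℤ) ≡ + length xs
∑-one []       = ∑-[] _
∑-one (x ∷ xs) = trans (∑-∷ x xs _) (cong (_+_ 1ℤ) (∑-one xs))

-- Each cycle starts at the first element of V that it contains, the convention of `cycles`; k is fuel,
-- and length V of it suffices.
decompositions : ℕ → List X → List (List (List X))
decompositions k       []      = [ [] ]
decompositions zero    (v ∷ V) = []
decompositions (suc k) (v ∷ V) =
  concatMap (λ (C , R) → concatMap (λ c → map ((v ∷ c) ∷_) (decompositions k R)) (perms C)) (shares V)

∑-decompositions-∷ : (k : ℕ) (v : X) (V : List X) (F : List (List X) → ℤ) →
  ∑ (decompositions (suc k) (v ∷ V)) F
    ≡ ∑ (shares V) (λ (C , R) → ∑ (perms C) (λ c → ∑ (decompositions k R) (λ Γ → F ((v ∷ c) ∷ Γ))))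
∑-decompositions-∷ k v V F = trans (∑-concatMap _ (shares V) F) (∑-ext (shares V) λ (C , R) →
  trans (∑-concatMap _ (perms C) F) (∑-ext (perms C) λ c → ∑-map _ (decompositions k R) F))

module _ {X : Set} where
  open Recursion {X = X} (λ _ _ → 1ℤ) (λ _ _ → 0ℤ) (λ _ _ → refl)

  pathProduct-1 : (w : List X) → pathProduct (λ _ _ → 1ℤ) w ≡ 1ℤ
  pathProduct-1 []          = refl
  pathProduct-1 (x ∷ [])    = refl
  pathProduct-1 (x ∷ y ∷ w) = trans (*-identityˡ _) (pathProduct-1 (y ∷ w))

  -- A closed walk has at least one arc, so its product of zeros vanishes.
  cycleWeight-1 : (v : X) (c : List X) → cycleWeight v c ≡ 1ℤ
  cycleWeight-1 v []      = refl
  cycleWeight-1 v (x ∷ c) = cong (λ s → 1ℤ * s - 0ℤ) (pathProduct-1 (x ∷ c ++ [ v ]))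

  -- With all paths and cycles of weight 1, `paths-∷` is a recursion for the number of arrangements,
  -- and the construction of `decompositions` follows the same recursion.
  ∑-decompositions-1 : (k : ℕ) (V : List X) → length V ≤ k →
    ∑ (decompositions k V) (λ _ → 1ℤ) ≡ ∑ (perms V) (λ _ → 1ℤ)
  ∑-decompositions-1 zero    []      l = trans (∑-[-] _ _) (sym (∑-[-] _ _))
  ∑-decompositions-1 (suc k) []      l = trans (∑-[-] _ _) (sym (∑-[-] _ _))
  ∑-decompositions-1 (suc k) (v ∷ V) (s≤s l) = begin
    ∑ (decompositions (suc k) (v ∷ V)) (λ _ → 1ℤ)
      ≡⟨ ∑-decompositions-∷ k v V _ ⟩
    ∑ (shares V) (λ (C , R) → ∑ (perms C) (λ c → ∑ (decompositions k R) (λ Γ → 1ℤ)))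
      ≡⟨ ∑-cong (shares V) (λ {(C , R)} i → ∑-ext (perms C) λ c → trans
           (∑-decompositions-1 k R (ℕₚ.≤-trans (subst (length R ≤_) (sym (∈-shares-length V i)) (ℕₚ.m≤n+m _ _)) l))
           (trans (∑-ext (perms R) λ w → sym (pathProduct-1 w))
             (trans (sym (*-identityˡ _)) (cong (_* paths R) (sym (cycleWeight-1 v c)))))) ⟩
    ∑ (shares V) (λ (C , R) → ∑ (perms C) (λ c → cycleWeight v c * paths R))
      ≡⟨ ∑-ext (shares V) (λ (C , R) → sym (∑-*ʳ (paths R) (perms C) _)) ⟩
    ∑ (shares V) (λ (C , R) → cyclesThrough v C * paths R)
      ≡⟨ sym (paths-∷ v V) ⟩
    paths (v ∷ V)
      ≡⟨ ∑-ext (perms (v ∷ V)) pathProduct-1 ⟩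
    ∑ (perms (v ∷ V)) (λ _ → 1ℤ) ∎

  length-decompositions : (k : ℕ) (V : List X) → length V ≤ k → length (decompositions k V) ≡ length (perms V)
  length-decompositions k V l =
    +-injective (trans (sym (∑-one (decompositions k V))) (trans (∑-decompositions-1 k V l) (∑-one (perms V))))

-- Cancellation of risky cycles

chain : (X → X → Bool) → List X → Bool
chain A []          = true
chain A (x ∷ [])    = true
chain A (x ∷ y ∷ w) = A x y ∧ chain A (y ∷ w)

chain-++ : (A : X → X → Bool) (p : List X) (v : X) (q : List X) →
  chain A (p ++ v ∷ q) ≡ chain A (p ++ [ v ]) ∧ chain A (v ∷ q)
chain-++ A []          v q = refl
chain-++ A (x ∷ [])    v q = cong (_∧ chain A (v ∷ q)) (sym (∧-identityʳ (A x v)))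
chain-++ A (x ∷ y ∷ p) v q = trans (cong (A x y ∧_) (chain-++ A (y ∷ p) v q)) (sym (∧-assoc (A x y) _ _))

chain-reverse : (A : X → X → Bool) (w : List X) → chain A (reverse w) ≡ chain (flip A) w
chain-reverse A []          = refl
chain-reverse A (x ∷ [])    = refl
chain-reverse A (x ∷ y ∷ w) = begin
  chain A (reverse (x ∷ y ∷ w))
    ≡⟨ cong (chain A) (trans (unfold-reverse x (y ∷ w)) (trans
         (cong (_++ [ x ]) (unfold-reverse y w))
         (++-assoc (reverse w) [ y ] [ x ]))) ⟩
  chain A (reverse w ++ y ∷ x ∷ [])
    ≡⟨ chain-++ A (reverse w) y [ x ] ⟩
  chain A (reverse w ++ [ y ]) ∧ (A y x ∧ true)
    ≡⟨ cong₂ _∧_ (trans (cong (chain A) (sym (unfold-reverse y w))) (chain-reverse A (y ∷ w))) (∧-identityʳ (A y x)) ⟩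
  chain (flip A) (y ∷ w) ∧ A y x
    ≡⟨ ∧-comm (chain (flip A) (y ∷ w)) (A y x) ⟩
  A y x ∧ chain (flip A) (y ∷ w) ∎

-- The reversal of `v ∷ c` begins at the last entry of `c`. Rotating its closed walk back to `v`
-- expresses it through `reverse c`, with the base point of the sum over `perms C` kept.
chain-rotate : (A : X → X → Bool) (v x : X) (d : List X) →
  chain A ((x ∷ d ++ [ v ]) ++ [ x ]) ≡ chain A (v ∷ x ∷ d ++ [ v ])
chain-rotate A v x d = begin
  chain A ((x ∷ d ++ [ v ]) ++ [ x ])    ≡⟨ cong (chain A) (++-assoc (x ∷ d) [ v ] [ x ]) ⟩
  chain A ((x ∷ d) ++ v ∷ [ x ])         ≡⟨ chain-++ A (x ∷ d) v [ x ] ⟩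
  chain A (x ∷ d ++ [ v ]) ∧ (A v x ∧ true) ≡⟨ cong (chain A (x ∷ d ++ [ v ]) ∧_) (∧-identityʳ (A v x)) ⟩
  chain A (x ∷ d ++ [ v ]) ∧ A v x       ≡⟨ ∧-comm _ (A v x) ⟩
  A v x ∧ chain A (x ∷ d ++ [ v ])       ∎

reverse-closed : (v : X) (c : List X) → reverse (v ∷ c ++ [ v ]) ≡ v ∷ reverse c ++ [ v ]
reverse-closed v c = trans (unfold-reverse v (c ++ [ v ])) (cong (_++ [ v ]) (reverse-++ c [ v ]))

chain-zip : (A : X → X → Bool) (x : X) (p : List X) (v : X) →
  all (λ e → A (proj₁ e) (proj₂ e)) (zip (x ∷ p) (p ++ [ v ])) ≡ chain A (x ∷ p ++ [ v ])
chain-zip A x []      v = refl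
chain-zip A x (y ∷ p) v = cong (A x y ∧_) (chain-zip A y p v)

occ-∉ : ∀ {n} (v : Fin n) (w : List (Fin n)) → v ∉ w → occ v w ≡ 0
occ-∉ v []      n = refl
occ-∉ v (x ∷ w) n with x ≟ v
... | yes refl = ⊥-elim (n (here refl))
... | no  _    = occ-∉ v w (n ∘ there)

occ-∈ : ∀ {n} {v : Fin n} {w : List (Fin n)} → Unique w → v ∈ w → occ v w ≡ 1
occ-∈ {v = v} {x ∷ w} (x∉ ∷ u) i with x ≟ v
... | yes refl = cong suc (occ-∉ x w (λ j → All.lookup x∉ j refl))
occ-∈ (x∉ ∷ u) (here refl) | no x≢v = ⊥-elim (x≢v refl)
occ-∈ (x∉ ∷ u) (there i)   | no x≢v = occ-∈ u i

all-true : (f : X → Bool) (xs : List X) → (∀ {x} → x ∈ xs → f x ≡ true) → all f xs ≡ true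
all-true f []       h = refl
all-true f (x ∷ xs) h = cong₂ _∧_ (h (here refl)) (all-true f xs (h ∘ there))

distinct-true : ∀ {n} {w : List (Fin n)} → Unique w → distinct w ≡ true
distinct-true {w = w} u = all-true _ w (λ {v} i → cong (_≡ᵇ 1) (occ-∈ u i))

isCycle-chain : ∀ {n} (A : Fin n → Fin n → Bool) {v : Fin n} {c : List (Fin n)} → Unique (v ∷ c) →
  isCycle A (v ∷ c) ≡ chain A (v ∷ c ++ [ v ])
isCycle-chain A {v} {c} u rewrite distinct-true u = chain-zip A v c v

isCycle-reverse : ∀ {n} (A : Fin n → Fin n → Bool) {v : Fin n} {c : List (Fin n)} → Unique (v ∷ c) →
  isCycle A (reverse (v ∷ c)) ≡ chain A (v ∷ reverse c ++ [ v ])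
isCycle-reverse A {v} {c} u
  rewrite unfold-reverse v c
  with u′ ← Unique-resp-↭ (↭-trans (↭-sym (↭-reverse (v ∷ c))) (↭.↭-reflexive (unfold-reverse v c))) u
  with reverse c
... | []    = isCycle-chain A u′
... | x ∷ d = trans (isCycle-chain A u′) (chain-rotate A v x d)

sgn : Bool → ℤ
sgn e = if e then 1ℤ else -1ℤ

even-suc : ∀ k → evenᵇ (suc k) ≡ not (evenᵇ k)
even-suc zero          = refl
even-suc (suc zero)    = refl
even-suc (suc (suc k)) = even-suc k

sgn-not : ∀ e → sgn (not e) ≡ - sgn e
sgn-not true  = refl
sgn-not false = refl

module Digraph {n : ℕ} (A : Fin n → Fin n → Bool) where

  β τ : Fin n → Fin n → ℤ
  β u v = ⟦ co A u v ⟧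
  τ u v = - ⟦ A u v ⟧

  β≡1+τ : ∀ u v → β u v ≡ 1ℤ + τ u v
  β≡1+τ u v with A u v
  ... | true  = refl
  ... | false = refl

  open Recursion β τ β≡1+τ public
  open SeriesRecursion β τ β≡1+τ public

  pathProduct-β : (w : List (Fin n)) → pathProduct β w ≡ ⟦ chain (co A) w ⟧
  pathProduct-β []          = refl
  pathProduct-β (x ∷ [])    = refl
  pathProduct-β (x ∷ y ∷ w) = trans (cong (β x y *_) (pathProduct-β (y ∷ w))) (sym (⟦∧⟧ (co A x y) _))

  pathProduct-τ : (x : Fin n) (p : List (Fin n)) → pathProduct τ (x ∷ p) ≡ sgn (evenᵇ (length p)) * ⟦ chain A (x ∷ p) ⟧
  pathProduct-τ x []      = refl
  pathProduct-τ x (y ∷ p) = begin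
    - ⟦ A x y ⟧ * pathProduct τ (y ∷ p)
      ≡⟨ cong (- ⟦ A x y ⟧ *_) (pathProduct-τ y p) ⟩
    - ⟦ A x y ⟧ * (sgn (evenᵇ (length p)) * ⟦ chain A (y ∷ p) ⟧)
      ≡⟨ lemma ⟦ A x y ⟧ (sgn (evenᵇ (length p))) ⟦ chain A (y ∷ p) ⟧ ⟩
    - sgn (evenᵇ (length p)) * (⟦ A x y ⟧ * ⟦ chain A (y ∷ p) ⟧)
      ≡⟨ cong₂ _*_ (sym (trans (cong sgn (even-suc (length p))) (sgn-not (evenᵇ (length p))))) (sym (⟦∧⟧ (A x y) _)) ⟩
    sgn (evenᵇ (suc (length p))) * ⟦ chain A (x ∷ y ∷ p) ⟧ ∎
    where
    lemma : ∀ a s c → - a * (s * c) ≡ - s * (a * c)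
    lemma = solve-∀

  -- The closed walk has `suc (length c)` arcs, each contributing a sign to the τ product. Thus a
  -- `A`-cycle counts +1 in odd length and -1 in even length.
  cycleWeight-chain : (v : Fin n) (c : List (Fin n)) → cycleWeight v c
    ≡ ⟦ chain (co A) (v ∷ c ++ [ v ]) ⟧ - sgn (evenᵇ (suc (length c))) * ⟦ chain A (v ∷ c ++ [ v ]) ⟧
  cycleWeight-chain v c = cong₂ _-_ (pathProduct-β (v ∷ c ++ [ v ]))
    (trans (pathProduct-τ v (c ++ [ v ])) (cong (λ l → sgn (evenᵇ l) * ⟦ chain A (v ∷ c ++ [ v ]) ⟧) len))
    where
    len : length (c ++ [ v ]) ≡ suc (length c)
    len = trans (length-++ c) (ℕₚ.+-comm (length c) 1)

  good : List (Fin n) → Bool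
  good γ = (isCycle A γ ∨ isCycle (co A) γ) ∧ not (risky A γ)

  -- The walk has at least one arc, and that arc cannot lie both in D and in its complement.
  chain-disjoint : (x : Fin n) (p : List (Fin n)) (v : Fin n) →
    chain A (x ∷ p ++ [ v ]) ≡ true → chain (co A) (x ∷ p ++ [ v ]) ≡ true → ⊥
  chain-disjoint x [] v h h′ with A x v
  chain-disjoint x [] v h () | true
  chain-disjoint x [] v () h′ | false
  chain-disjoint x (y ∷ p) v h h′ with A x y
  chain-disjoint x (y ∷ p) v h () | true
  chain-disjoint x (y ∷ p) v () h′ | false

  module Asymmetric (asym : ∀ u v → u ≢ v → A u v ≡ true → A v u ≡ true → ⊥) where

    asym-co : ∀ {u v} → u ≢ v → A v u ≡ true → co A u v ≡ true
    asym-co {u} {v} u≢v h with A u v in eq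
    ... | true  = ⊥-elim (asym u v u≢v eq h)
    ... | false = refl

    chain-flip : (x : Fin n) (p : List (Fin n)) (v : Fin n) → Unique (x ∷ p) → v ∉ x ∷ p →
      chain (flip A) (x ∷ p ++ [ v ]) ≡ true → chain (co A) (x ∷ p ++ [ v ]) ≡ true
    chain-flip x [] v u v∉ h = cong (_∧ true) (asym-co {x} {v} (λ { refl → v∉ (here refl) }) (∧-conicalˡ _ _ h))
    chain-flip x (y ∷ p) v ((x≢y ∷ _) ∷ u) v∉ h =
      cong₂ _∧_ (asym-co x≢y (∧-conicalˡ _ _ h)) (chain-flip y p v u (v∉ ∘ there) (∧-conicalʳ (A y x) _ h))

    -- Even length excludes a loop, which is its own reversal and beyond the reach of asymmetry. In
    -- a longer cycle consecutive vertices differ, so reversing an arc of D gives an arc of the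
    -- complement.
    cycle-flip : (v : Fin n) (c : List (Fin n)) → Unique (v ∷ c) → evenᵇ (suc (length c)) ≡ true →
      chain (flip A) (v ∷ c ++ [ v ]) ≡ true → chain (co A) (v ∷ c ++ [ v ]) ≡ true
    cycle-flip v (x ∷ p) (v∉@(v≢x ∷ _) ∷ u) e h =
      cong₂ _∧_ (asym-co v≢x (∧-conicalˡ _ _ h))
        (chain-flip x p v u (λ i → All.lookup v∉ i refl) (∧-conicalʳ (A x v) _ h))

    -- e: even length; a, b, r: the cycle, the cycle in the complement, the reversed cycle lies in D.
    good-balance : (e a b r : Bool) → (a ≡ true → b ≡ true → ⊥) → (e ≡ true → r ≡ true → b ≡ true) →
      ⟦ (a ∨ b) ∧ not (e ∧ (a ∨ r)) ⟧ + ⟦ e ⟧ * ⟦ r ⟧ ≡ (⟦ b ⟧ - sgn e * ⟦ a ⟧) + ⟦ e ⟧ * ⟦ a ⟧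
    good-balance e     true  true  r     p q = ⊥-elim (p refl refl)
    good-balance true  a     false true  p q with () ← q refl refl
    good-balance true  true  false false p q = refl
    good-balance true  false true  true  p q = refl
    good-balance true  false true  false p q = refl
    good-balance true  false false false p q = refl
    good-balance false true  false r     p q = refl
    good-balance false false true  r     p q = refl
    good-balance false false false r     p q = refl

    -- The indicator of an even D-cycle, added to both sides as a correction: at `reverse c` on one
    -- side and at `c` on the other. The balance then holds term by term, and the corrections agree
    -- once summed over all arrangements.
    ring : Fin n → List (Fin n) → ℤ
    ring v c = ⟦ evenᵇ (suc (length c)) ⟧ * ⟦ chain A (v ∷ c ++ [ v ]) ⟧

    good-cycleWeight : {v : Fin n} {c : List (Fin n)} → Unique (v ∷ c) →
      ⟦ good (v ∷ c) ⟧ + ring v (reverse c) ≡ cycleWeight v c + ring v c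
    good-cycleWeight {v} {c} u
      rewrite isCycle-chain A u | isCycle-chain (co A) u | isCycle-reverse A u | length-reverse c
      = trans (good-balance (evenᵇ (suc (length c))) _ _ _ (chain-disjoint v c v)
          (λ e h → cycle-flip v c u e (trans
            (sym (chain-reverse A (v ∷ c ++ [ v ])))
            (trans (cong (chain A) (reverse-closed v c)) h))))
        (cong (_+ ring v c) (sym (cycleWeight-chain v c)))

    cyclesThrough-good : (v : Fin n) {C : List (Fin n)} → Unique (v ∷ C) →
      ∑ (perms C) (λ c → ⟦ good (v ∷ c) ⟧) ≡ cyclesThrough v C
    cyclesThrough-good v {C} u@(_ ∷ uC) = ∙-cancelʳ +-0-abelianGroup (∑ (perms C) (ring v)) _ _ (begin
      ∑ (perms C) (λ c → ⟦ good (v ∷ c) ⟧) + ∑ (perms C) (ring v)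
        ≡⟨ cong (_+_ (∑ (perms C) (λ c → ⟦ good (v ∷ c) ⟧))) (sym (∑-perms-reverse uC (ring v))) ⟩
      ∑ (perms C) (λ c → ⟦ good (v ∷ c) ⟧) + ∑ (perms C) (ring v ∘ reverse)
        ≡⟨ sym (∑-+ (perms C) _ _) ⟩
      ∑ (perms C) (λ c → ⟦ good (v ∷ c) ⟧ + ring v (reverse c))
        ≡⟨ ∑-cong (perms C) (λ i → good-cycleWeight (Unique-resp-↭ (↭-prep v (↭-sym (∈-perms⁻ C i))) u)) ⟩
      ∑ (perms C) (λ c → cycleWeight v c + ring v c)
        ≡⟨ ∑-+ (perms C) _ _ ⟩
      cyclesThrough v C + ∑ (perms C) (ring v) ∎)

    blockWeight-[] : ∀ α → blockWeight [] α ≡ + oneS α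
    blockWeight-[] []          = refl
    blockWeight-[] (zero ∷ α)  = trans (∑-[-] _ _) (trans (cong (1ℤ *_) (blockWeight-[] α)) (*-identityˡ _))
    blockWeight-[] (suc a ∷ α) = ∑-[-] _ _

    term : List (List (Fin n)) → List ℕ → ℤ
    term Γ α = ⟦ all good Γ ⟧ * + pλ (map length Γ) α

    decompositionSeries-[] : ∀ k α → ∑ (decompositions k []) (λ Γ → term Γ α) ≡ blockSeries [] α
    decompositionSeries-[] k α = trans (∑-[-] _ _) (trans (*-identityˡ _)
      (sym (trans (∑-[-] _ _) (blockWeight-[] α))))

    -- Peeling off the cycle through `v` brings both sides to the recursion of `cycleExpansion`. The
    -- indicator `good` may stand for `cycleWeight` only after summation over `perms C`, where the
    -- totals agree although single terms can differ.
    decompositionSeries : (k : ℕ) (V : List (Fin n)) → length V ≤ k → Unique V → ∀ α →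
      ∑ (decompositions k V) (λ Γ → term Γ α) ≡ blockSeries V α
    decompositionSeries zero    []      l u α = decompositionSeries-[] zero α
    decompositionSeries (suc k) []      l u α = decompositionSeries-[] (suc k) α
    decompositionSeries (suc k) (v ∷ V) (s≤s l) u@(v∉ ∷ uV) α = begin
      ∑ (decompositions (suc k) (v ∷ V)) (λ Γ → term Γ α)
        ≡⟨ ∑-decompositions-∷ k v V _ ⟩
      ∑ (shares V) (λ (C , R) → ∑ (perms C) (λ c → ∑ (decompositions k R) (λ Γ → term ((v ∷ c) ∷ Γ) α)))
        ≡⟨ ∑-cong (shares V) (λ {(C , R)} i → trans
             (∑-cong (perms C) λ {c} j → trans
               -- All arrangements of `C` have one length, hence give the same power sum; only the
               -- indicator still depends on `c`.
               (∑-ext (decompositions k R) λ Γ → factor c C Γ (↭-length (∈-perms⁻ C j)))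
               (trans (sym (∑-*ˡ ⟦ good (v ∷ c) ⟧ (decompositions k R) _)) (cong (⟦ good (v ∷ c) ⟧ *_) (rest i))))
             (trans (sym (∑-*ʳ (powerSumTimes (suc (length C)) (blockSeries R) α) (perms C) _))
               (cong (_* powerSumTimes (suc (length C)) (blockSeries R) α) (cyclesThrough-good v (unique-∷ i))))) ⟩
      ∑ (shares V) (λ (C , R) → cyclesThrough v C * powerSumTimes (suc (length C)) (blockSeries R) α)
        ≡⟨ sym (cycleExpansion v V α) ⟩
      blockSeries (v ∷ V) α ∎
      where
      unique-++ : {C R : List (Fin n)} → (C , R) ∈ shares V → Unique (v ∷ C ++ R)
      unique-++ i = Unique-resp-↭ (↭-prep v (↭-sym (∈-shares⁻ V i))) u
      unique-∷ : {C R : List (Fin n)} → (C , R) ∈ shares V → Unique (v ∷ C)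
      unique-∷ {C} i = unique-++⁻ˡ (v ∷ C) (unique-++ i)
      unique-R : {C R : List (Fin n)} → (C , R) ∈ shares V → Unique R
      unique-R {C} i = unique-++⁻ʳ (v ∷ C) (unique-++ i)
      rest : {C R : List (Fin n)} → (C , R) ∈ shares V →
        ∑ (decompositions k R) (λ Γ → ⟦ all good Γ ⟧ * powerSumTimes (suc (length C)) (λ γ → + pλ (map length Γ) γ) α)
          ≡ powerSumTimes (suc (length C)) (blockSeries R) α
      rest {C} {R} i = trans
        (sym (powerSumTimes-∑ (suc (length C)) (decompositions k R)
          (λ Γ → ⟦ all good Γ ⟧) (λ Γ γ → + pλ (map length Γ) γ) α))
        (powerSumTimes-ext (suc (length C)) (decompositionSeries k R
          (ℕₚ.≤-trans (subst (length R ≤_) (sym (∈-shares-length V i)) (ℕₚ.m≤n+m _ _)) l) (unique-R i)) α)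
      factor : ∀ c C Γ → length c ≡ length C → term ((v ∷ c) ∷ Γ) α
        ≡ ⟦ good (v ∷ c) ⟧ * (⟦ all good Γ ⟧ * powerSumTimes (suc (length C)) (λ γ → + pλ (map length Γ) γ) α)
      factor c C Γ e = trans
        (cong₂ _*_ (⟦∧⟧ (good (v ∷ c)) (all good Γ))
          (trans (+powerSum⊗ (suc (length c)) (pλ (map length Γ)) α)
            (cong (λ l → powerSumTimes (suc l) (λ γ → + pλ (map length Γ) γ) α) e)))
        (*-assoc ⟦ good (v ∷ c) ⟧ _ _)

-- Coefficients of U_D

-- `strictAt` carries absolute positions, so deleting the first letter of a word shifts its descent
-- predicate by one.
strictAt-shift : {I J : ℕ → Bool} → (∀ p → I (suc (suc p)) ≡ J (suc p)) →
  ∀ p e → strictAt I (suc (suc p)) e ≡ strictAt J (suc p) e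
strictAt-shift h p []          = refl
strictAt-shift h p (x ∷ [])    = refl
strictAt-shift h p (x ∷ y ∷ e) =
  cong₂ (λ i r → (not i ∨ (x <ᵇ y)) ∧ r) (h p) (strictAt-shift h (suc p) (y ∷ e))

expandFrom-≥ : ∀ i α → All (λ j → i ≤ j) (expandFrom i α)
expandFrom-≥ i []      = []
expandFrom-≥ i (a ∷ α) =
  Allₚ.++⁺ (Allₚ.replicate⁺ a ℕₚ.≤-refl) (All.map (ℕₚ.≤-trans (ℕₚ.n≤1+n i)) (expandFrom-≥ (suc i) α))

<ᵇ-true : ∀ {i j} → i ℕ.< j → (i <ᵇ j) ≡ true
<ᵇ-true p = Equivalence.to T-≡ (ℕₚ.<⇒<ᵇ p)

<ᵇ-irrefl : ∀ i → (i <ᵇ i) ≡ false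
<ᵇ-irrefl zero    = refl
<ᵇ-irrefl (suc i) = <ᵇ-irrefl i

∑-cuts-zero : (w : List X) (f g : List X → ℤ) →
  ∑ (cuts w) (λ (p , q) → ⟦ length p ≡ᵇ 0 ⟧ * f p * g q) ≡ f [] * g w
∑-cuts-zero []      f g = trans (∑-[-] _ _) (cong (_* g []) (*-identityˡ (f [])))
∑-cuts-zero (x ∷ w) f g = trans (∑-cuts-∷ x w _) (trans
  (cong₂ _+_ (cong (_* g (x ∷ w)) (*-identityˡ (f []))) (∑-zero (cuts w))) (+-identityʳ (f [] * g (x ∷ w))))

∑-cuts-suc : (x : X) (w : List X) (a : ℕ) (f g : List X → ℤ) →
  ∑ (cuts (x ∷ w)) (λ (p , q) → ⟦ length p ≡ᵇ suc a ⟧ * f p * g q)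
    ≡ ∑ (cuts w) (λ (p , q) → ⟦ length p ≡ᵇ a ⟧ * f (x ∷ p) * g q)
∑-cuts-suc x w a f g = trans (∑-cuts-∷ x w _) (+-identityˡ _)

module Blocks {n : ℕ} (A : Fin n → Fin n → Bool) where
  open Digraph A

  -- The condition in `L`, with `length w` in place of `n` so that it also applies to the suffixes
  -- met in the recursion.
  compatible : List (Fin n) → List ℕ → Bool
  compatible w e = (length e ≡ᵇ length w) ∧ strictAt (desAt A w) 1 e

  compatible-∷ : ∀ x y w i j e →
    compatible (x ∷ y ∷ w) (i ∷ j ∷ e) ≡ (not (A x y) ∨ (i <ᵇ j)) ∧ compatible (y ∷ w) (j ∷ e)
  compatible-∷ x y w i j e = begin
    l ∧ (s ∧ strictAt (desAt A (x ∷ y ∷ w)) 2 (j ∷ e))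
      ≡⟨ cong (λ r → l ∧ (s ∧ r)) (strictAt-shift {J = desAt A (y ∷ w)} (λ p → refl) 0 (j ∷ e)) ⟩
    l ∧ (s ∧ r)  ≡⟨ sym (∧-assoc l s r) ⟩
    (l ∧ s) ∧ r  ≡⟨ cong (_∧ r) (∧-comm l s) ⟩
    (s ∧ l) ∧ r  ≡⟨ ∧-assoc s l r ⟩
    s ∧ (l ∧ r)  ∎
    where
    l = length e ≡ᵇ length w
    s = not (A x y) ∨ (i <ᵇ j)
    r = strictAt (desAt A (y ∷ w)) 1 (j ∷ e)

  -- A strict increase satisfies the condition whether or not there is a descent, so the arc joining
  -- two blocks is unconstrained.
  compatible-< : ∀ x w i e → All (i ℕ.<_) e → compatible (x ∷ w) (i ∷ e) ≡ compatible w e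
  compatible-< x w       i []      _       = refl
  compatible-< x []      i (j ∷ e) _       = refl
  compatible-< x (y ∷ w) i (j ∷ e) (p ∷ _) = trans (compatible-∷ x y w i j e)
    (cong (_∧ compatible (y ∷ w) (j ∷ e)) (trans (cong (not (A x y) ∨_) (<ᵇ-true p)) (∨-zeroʳ (not (A x y)))))

  -- Between two equal values a descent is forbidden, so each arc inside the block contributes its
  -- β; the step out of the block is free by `compatible-<`. Only the cut after `a` letters survives
  -- in the sum.
  compatible-blocks : ∀ a w i e → All (i ℕ.<_) e → ⟦ compatible w (replicate a i ++ e) ⟧
    ≡ ∑ (cuts w) (λ (p , q) → ⟦ length p ≡ᵇ a ⟧ * pathProduct β p * ⟦ compatible q e ⟧)
  compatible-blocks zero          w           i e h = sym (trans
    (∑-cuts-zero w (pathProduct β) (λ q → ⟦ compatible q e ⟧)) (*-identityˡ _))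
  compatible-blocks (suc a)       []          i e h = sym (∑-[-] _ _)
  compatible-blocks (suc zero)    (x ∷ w)     i e h = begin
    ⟦ compatible (x ∷ w) (i ∷ e) ⟧
      ≡⟨ cong ⟦_⟧ (compatible-< x w i e h) ⟩
    ⟦ compatible w e ⟧
      ≡⟨ sym (*-identityˡ _) ⟩
    1ℤ * ⟦ compatible w e ⟧
      ≡⟨ sym (trans (∑-cuts-suc x w 0 (pathProduct β) _)
           (∑-cuts-zero w (pathProduct β ∘ (x ∷_)) (λ q → ⟦ compatible q e ⟧))) ⟩
    ∑ (cuts (x ∷ w)) (λ (p , q) → ⟦ length p ≡ᵇ 1 ⟧ * pathProduct β p * ⟦ compatible q e ⟧) ∎
  compatible-blocks (suc (suc a)) (x ∷ [])    i e h = sym (trans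
    (∑-cuts-suc x [] (suc a) (pathProduct β) (λ q → ⟦ compatible q e ⟧)) (∑-[-] _ _))
  compatible-blocks (suc (suc a)) (x ∷ y ∷ w) i e h = begin
    ⟦ compatible (x ∷ y ∷ w) (i ∷ i ∷ replicate a i ++ e) ⟧
      ≡⟨ cong ⟦_⟧ (compatible-∷ x y w i i (replicate a i ++ e)) ⟩
    ⟦ (not (A x y) ∨ (i <ᵇ i)) ∧ compatible (y ∷ w) (i ∷ replicate a i ++ e) ⟧
      ≡⟨ ⟦∧⟧ (not (A x y) ∨ (i <ᵇ i)) _ ⟩
    ⟦ not (A x y) ∨ (i <ᵇ i) ⟧ * ⟦ compatible (y ∷ w) (i ∷ replicate a i ++ e) ⟧
      ≡⟨ cong₂ _*_ (cong ⟦_⟧ (trans (cong (not (A x y) ∨_) (<ᵇ-irrefl i)) (∨-identityʳ (not (A x y)))))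
           (trans (compatible-blocks (suc a) (y ∷ w) i e h) (∑-cuts-suc y w a (pathProduct β) _)) ⟩
    β x y * ∑ (cuts w) (λ (p , q) → ⟦ length p ≡ᵇ a ⟧ * pathProduct β (y ∷ p) * ⟦ compatible q e ⟧)
      ≡⟨ ∑-*ˡ (β x y) (cuts w) _ ⟩
    ∑ (cuts w) (λ (p , q) → β x y * (⟦ length p ≡ᵇ a ⟧ * pathProduct β (y ∷ p) * ⟦ compatible q e ⟧))
      ≡⟨ ∑-ext (cuts w) (λ (p , q) → lemma (β x y) ⟦ length p ≡ᵇ a ⟧ (pathProduct β (y ∷ p)) ⟦ compatible q e ⟧) ⟩
    ∑ (cuts w) (λ (p , q) → ⟦ length p ≡ᵇ a ⟧ * pathProduct β (x ∷ y ∷ p) * ⟦ compatible q e ⟧)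
      ≡⟨ sym (trans (∑-cuts-suc x (y ∷ w) (suc a) (pathProduct β) _) (∑-cuts-suc y w a (pathProduct β ∘ (x ∷_)) _)) ⟩
    ∑ (cuts (x ∷ y ∷ w)) (λ (p , q) → ⟦ length p ≡ᵇ suc (suc a) ⟧ * pathProduct β p * ⟦ compatible q e ⟧) ∎
    where
    lemma : ∀ b i c d → b * (i * c * d) ≡ i * (b * c) * d
    lemma = solve-∀

  compatible-expandFrom : ∀ w i α → ⟦ compatible w (expandFrom i α) ⟧ ≡ blockWeight w α
  compatible-expandFrom w i []      = cong ⟦_⟧ (∧-identityʳ (0 ≡ᵇ length w))
  compatible-expandFrom w i (a ∷ α) = trans
    (compatible-blocks a w i (expandFrom (suc i) α) (expandFrom-≥ (suc i) α))
    (∑-ext (cuts w) λ (p , q) → cong (⟦ length p ≡ᵇ a ⟧ * pathProduct β p *_) (compatible-expandFrom q (suc i) α))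

  L-blockWeight : ∀ w α → + L (desAt A w) (length w) α ≡ blockWeight w α
  L-blockWeight w α = trans (+if _ 1) (trans (*-identityʳ _) (compatible-expandFrom w 1 α))

-- Listings and the cycles of a permutation

tuples-unique : ∀ n k → Unique (tuples n k)
tuples-unique n zero    = [] ∷ []
tuples-unique n (suc k) = concatMap-unique _ (Uniqueₚ.allFin⁺ n)
  (λ _ → Uniqueₚ.map⁺ ∷ᵥ-injectiveʳ (tuples-unique n k))
  (λ _ _ i j → let (_ , _ , e) = ∈-map⁻ _ i; (_ , _ , e′) = ∈-map⁻ _ j in ∷ᵥ-injectiveˡ (trans (sym e) e′))

∈-tuples : (w : Vec (Fin n) k) → w ∈ tuples n k
∈-tuples []ᵥ      = here refl
∈-tuples (x ∷ᵥ w) = ∈-concatMap⁺ _ (lose (∈-allFin x) (∈-map⁺ _ (∈-tuples w)))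

toList-injective : (v w : Vec X k) → toList v ≡ toList w → v ≡ w
toList-injective []ᵥ      []ᵥ      e = refl
toList-injective (x ∷ᵥ v) (y ∷ᵥ w) e = cong₂ _∷ᵥ_ (∷-injectiveˡ e) (toList-injective v w (∷-injectiveʳ e))

toList-surjective : (u : List X) → length u ≡ k → Σ (Vec X k) λ w → toList w ≡ u
toList-surjective u refl = fromList u , toList∘fromList u

T⇒≡ : {b : Bool} → T b → b ≡ true
T⇒≡ = Equivalence.to T-≡

≡⇒T : {b : Bool} → b ≡ true → T b
≡⇒T = Equivalence.from T-≡

all-∈ : (f : X → Bool) {xs : List X} {x : X} → all f xs ≡ true → x ∈ xs → f x ≡ true
all-∈ f h (here refl) = ∧-conicalˡ _ _ h
all-∈ f {y ∷ _} h (there i) = all-∈ f (∧-conicalʳ (f y) _ h) i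

length-allFin : ∀ n → length (allFin n) ≡ n
length-allFin n = length-tabulate {n = n} (λ i → i)

occ≢0⇒∈ : (v : Fin n) (w : List (Fin n)) → occ v w ≢ 0 → v ∈ w
occ≢0⇒∈ v []      h = ⊥-elim (h refl)
occ≢0⇒∈ v (x ∷ w) h with x ≟ v
... | yes refl = here refl
... | no  _    = there (occ≢0⇒∈ v w h)

listings-unique : ∀ n → Unique (listings n)
listings-unique n = Uniqueₚ.filter⁺ (T? ∘ isListing) (tuples-unique n n)

-- Every vertex occurs and the lengths agree, so the pigeonhole principle applies.
∈-listings⁻ : {w : Vec (Fin n) n} → w ∈ listings n → toList w ↭ allFin n
∈-listings⁻ {n} {w} i = ↭-sym (unique-⊆⇒↭ (Uniqueₚ.allFin⁺ n)
  (λ {v} v∈ → occ≢0⇒∈ v (toList w) λ e → ≢1 (trans (cong (_≡ᵇ 1) (sym e)) (all-∈ _ isL v∈)))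
  (ℕₚ.≤-reflexive (trans (length-toList w) (sym (length-allFin n)))))
  where
  isL : isListing w ≡ true
  isL = T⇒≡ (proj₂ (∈-filter⁻ (T? ∘ isListing) {xs = tuples n n} i))
  ≢1 : (0 ≡ᵇ 1) ≡ true → ⊥
  ≢1 ()

∈-listings⁺ : (w : Vec (Fin n) n) → toList w ↭ allFin n → w ∈ listings n
∈-listings⁺ {n} w p = ∈-filter⁺ (T? ∘ isListing) (∈-tuples w) (≡⇒T (all-true _ (allFin n)
  λ {v} v∈ → cong (_≡ᵇ 1) (occ-∈ (Unique-resp-↭ (↭-sym p) (Uniqueₚ.allFin⁺ n)) (∈-resp-↭ (↭-sym p) v∈))))

listings-perms : ∀ n → map toList (listings n) ↭ perms (allFin n)
listings-perms n = unique-set⇒↭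
  (Uniqueₚ.map⁺ (toList-injective _ _) (listings-unique n)) (perms-unique (Uniqueₚ.allFin⁺ n)) to from
  where
  to : ∀ {u} → u ∈ map toList (listings n) → u ∈ perms (allFin n)
  to i with w , j , refl ← ∈-map⁻ toList i = ∈-perms⁺ (allFin n) (∈-listings⁻ j)
  from : ∀ {u} → u ∈ perms (allFin n) → u ∈ map toList (listings n)
  from {u} i
    with p ← ∈-perms⁻ (allFin n) i
    with w , refl ← toList-surjective u (trans (↭-length p) (length-allFin n))
    = ∈-map⁺ toList (∈-listings⁺ w p)

lookup-∈ : (w : Vec X k) (i : Fin k) → lookup w i ∈ toList w
lookup-∈ (x ∷ᵥ w) zero    = here refl
lookup-∈ (x ∷ᵥ w) (suc i) = there (lookup-∈ w i)

lookup-injective : (w : Vec X k) → Unique (toList w) → ∀ {i j} → lookup w i ≡ lookup w j → i ≡ j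
lookup-injective (x ∷ᵥ w) (x∉ ∷ u) {zero}  {zero}  e = refl
lookup-injective (x ∷ᵥ w) (x∉ ∷ u) {zero}  {suc j} e = ⊥-elim (All.lookup x∉ (lookup-∈ w j) e)
lookup-injective (x ∷ᵥ w) (x∉ ∷ u) {suc i} {zero}  e = ⊥-elim (All.lookup x∉ (lookup-∈ w i) (sym e))
lookup-injective (x ∷ᵥ w) (x∉ ∷ u) {suc i} {suc j} e = cong suc (lookup-injective w u e)

lookup-ext : (v w : Vec X k) → (∀ i → lookup v i ≡ lookup w i) → v ≡ w
lookup-ext v w h = trans (sym (tabulate∘lookup v)) (trans (tabulate-cong h) (tabulate∘lookup w))

∈-shares-filter : {P : X → Set} (P? : Decidable P) (V : List X) → (filter P? V , filter (¬? ∘ P?) V) ∈ shares V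
∈-shares-filter P? []      = here refl
∈-shares-filter P? (x ∷ V) with does (P? x)
... | true  = ∈-++⁺ˡ (∈-map⁺ _ (∈-shares-filter P? V))
... | false = ∈-++⁺ʳ (map _ (shares V)) (∈-map⁺ _ (∈-shares-filter P? V))

filterᵇ-filter : (f : X → Bool) {P : X → Set} (P? : Decidable P) (V : List X) →
  (∀ {x} → x ∈ V → ¬ P x → f x ≡ false) → filterᵇ f V ≡ filterᵇ f (filter P? V)
filterᵇ-filter f P? []      h = refl
filterᵇ-filter f P? (x ∷ V) h with P? x
... | yes _ with f x
...   | true  = cong (x ∷_) (filterᵇ-filter f P? V (h ∘ there))
...   | false = filterᵇ-filter f P? V (h ∘ there)
filterᵇ-filter f P? (x ∷ V) h | no ¬p rewrite h (here refl) ¬p = filterᵇ-filter f P? V (h ∘ there)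

zip-map : (f : X → Y) (xs : List X) → zip xs (map f xs) ≡ map (λ x → x , f x) xs
zip-map f []       = refl
zip-map f (x ∷ xs) = cong (_ ∷_) (zip-map f xs)

∈-decompositions⁻ : (k : ℕ) (V : List X) {Γ : List (List X)} → Γ ∈ decompositions k V → concat Γ ↭ V
∈-decompositions⁻ zero    []      (here refl) = ↭.refl
∈-decompositions⁻ (suc k) []      (here refl) = ↭.refl
∈-decompositions⁻ (suc k) (v ∷ V) i
  with (C , R) , CR∈ , j ← find (∈-concatMap⁻ _ {xs = shares V} i)
  with c , c∈ , l ← find (∈-concatMap⁻ _ {xs = perms C} j)
  with Γ , Γ∈ , refl ← ∈-map⁻ _ l
  = ↭-prep v (↭-trans (++⁺ (∈-perms⁻ C c∈) (∈-decompositions⁻ k R Γ∈)) (∈-shares⁻ V CR∈))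

-- Orbits of an injective map

module Orbits {n : ℕ} (σ : Fin n → Fin n) (σ-injective : ∀ {i j} → σ i ≡ σ j → i ≡ j) where

  -- The part of the orbit of i visited so far, latest vertex first.
  data Trail (i : Fin n) : List (Fin n) → Set where
    start : Trail i [ i ]
    step  : ∀ {y ys} → Trail i (y ∷ ys) → Trail i (σ y ∷ y ∷ ys)

  trail-preimage : ∀ {i y ys z} → Trail i (y ∷ ys) → z ∈ y ∷ ys → z ≡ i ⊎ Σ (Fin n) λ u → u ∈ ys × z ≡ σ u
  trail-preimage start    (here refl) = inj₁ refl
  trail-preimage (step t) (here refl) = inj₂ (_ , here refl , refl)
  trail-preimage (step t) (there j) with trail-preimage t j
  ... | inj₁ e             = inj₁ e
  ... | inj₂ (u , u∈ , e) = inj₂ (u , there u∈ , e)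

  -- A visited vertex other than `i` is the image of a vertex visited before `y`. Were it `σ y`,
  -- injectivity would make `y` a repetition.
  trail-fresh : ∀ {i y ys} → Trail i (y ∷ ys) → Unique (y ∷ ys) → σ y ≢ i → σ y ∉ y ∷ ys
  trail-fresh t (y∉ ∷ _) σy≢i j with trail-preimage t j
  ... | inj₁ e            = σy≢i e
  ... | inj₂ (u , u∈ , e) = All.lookup y∉ u∈ (σ-injective e)

  -- The invariant is that fuel and the vertices behind `y` together number at least `n`. Without
  -- fuel there would be more than `n` distinct visited vertices, so the walk ends only by returning
  -- to `i`; then applying `σ` rotates the orbit by one place.
  orbitGo-spec : ∀ i f y ys → Trail i (y ∷ ys) → Unique (y ∷ ys) → n ≤ f ℕ.+ length ys →
    map σ (y ∷ orbitGo σ i f (σ y)) ≡ orbitGo σ i f (σ y) ++ [ i ] × Unique (orbitGo σ i f (σ y) ++ y ∷ ys)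
  orbitGo-spec i zero y ys t u l = ⊥-elim (ℕₚ.<-irrefl refl (ℕₚ.≤-trans (s≤s l)
    (subst (suc (length ys) ≤_) (length-allFin n) (unique-⊆⇒length≤ u (λ {x} _ → ∈-allFin x)))))
  orbitGo-spec i (suc f) y ys t u l with σ y ≟ i
  ... | yes σy≡i = cong [_] σy≡i , u
  ... | no σy≢i with e , u′ ← orbitGo-spec i f (σ y) (y ∷ ys) (step t)
                       (All.tabulate (λ j e → trail-fresh t u σy≢i (subst (_∈ y ∷ ys) (sym e) j)) ∷ u)
                       (subst (n ≤_) (sym (ℕₚ.+-suc f (length ys))) l)
    = cong (σ y ∷_) e , Unique-resp-↭ (shift (σ y) (orbitGo σ i f (σ (σ y))) (y ∷ ys)) u′

  orbit-spec : ∀ i → map σ (orbit σ i) ≡ orbitGo σ i n (σ i) ++ [ i ] × Unique (orbitGo σ i n (σ i) ++ [ i ])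
  orbit-spec i = orbitGo-spec i n i [] start ([] ∷ []) (ℕₚ.m≤m+n n 0)

  orbit-map : ∀ i → map σ (orbit σ i) ≡ orbitGo σ i n (σ i) ++ [ i ]
  orbit-map i = proj₁ (orbit-spec i)

  rotation : ∀ i → orbitGo σ i n (σ i) ++ [ i ] ↭ orbit σ i
  rotation i = ↭-trans (shift i _ []) (↭-prep i (↭.↭-reflexive (++-identityʳ _)))

  orbit-unique : ∀ i → Unique (orbit σ i)
  orbit-unique i = Unique-resp-↭ (rotation i) (proj₂ (orbit-spec i))

  map-orbit : ∀ i → map σ (orbit σ i) ↭ orbit σ i
  map-orbit i = ↭-trans (↭.↭-reflexive (orbit-map i)) (rotation i)

  orbit-closed : ∀ {i x} → x ∈ orbit σ i → σ x ∈ orbit σ i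
  orbit-closed {i} x∈ = ∈-resp-↭ (map-orbit i) (∈-map⁺ σ x∈)

  orbit-preimage : ∀ {i x} → σ x ∈ orbit σ i → x ∈ orbit σ i
  orbit-preimage {i} {x} σx∈ with u , u∈ , e ← ∈-map⁻ σ (∈-resp-↭ (↭-sym (map-orbit i)) σx∈) =
    subst (_∈ orbit σ i) (sym (σ-injective e)) u∈

  orbitGo-⊆ : ∀ {V} → (∀ {x} → x ∈ V → σ x ∈ V) → ∀ i f {x} → x ∈ V → All (_∈ V) (orbitGo σ i f x)
  orbitGo-⊆ cl i zero        x∈ = []
  orbitGo-⊆ cl i (suc f) {x} x∈ with x ≟ i
  ... | yes _ = []
  ... | no  _ = x∈ ∷ orbitGo-⊆ cl i f (cl x∈)

  orbit-⊆ : ∀ {V} → (∀ {x} → x ∈ V → σ x ∈ V) → ∀ {i} → i ∈ V → All (_∈ V) (orbit σ i)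
  orbit-⊆ cl {i} i∈ = i∈ ∷ orbitGo-⊆ cl i n (cl i∈)

  -- Closedness carries membership forward along the walk to its end. Applied to the orbit of `x`,
  -- with end `i`, it makes the orbit relation symmetric.
  reaches-end : ∀ {V} → (∀ {x} → x ∈ V → σ x ∈ V) → ∀ y ps {z x} →
    map σ (y ∷ ps) ≡ ps ++ [ z ] → x ∈ y ∷ ps → x ∈ V → z ∈ V
  reaches-end {V} cl y []        e (here refl) x∈V = subst (_∈ V) (∷-injectiveˡ e) (cl x∈V)
  reaches-end {V} cl y (y′ ∷ ps) e (here refl) x∈V =
    reaches-end cl y′ ps (∷-injectiveʳ e) (here refl) (subst (_∈ V) (∷-injectiveˡ e) (cl x∈V))
  reaches-end     cl y (y′ ∷ ps) e (there i)   x∈V = reaches-end cl y′ ps (∷-injectiveʳ e) i x∈V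

  orbit-sym : ∀ {i x} → x ∈ orbit σ i → i ∈ orbit σ x
  orbit-sym {i} {x} x∈ = reaches-end {V = orbit σ x} orbit-closed i _ (orbit-map i) x∈ (here refl)

  carcs-orbit : ∀ i → carcs (orbit σ i) ≡ map (λ x → x , σ x) (orbit σ i)
  carcs-orbit i = trans (cong (zip (orbit σ i)) (sym (orbit-map i))) (zip-map σ (orbit σ i))

  isLeast : Fin n → Bool
  isLeast i = all (λ j → toℕ i ≤ᵇ toℕ j) (orbit σ i)

  _∈?_ : (x : Fin n) (c : List (Fin n)) → Dec (x ∈ c)
  _∈?_ = member? _≟_

  -- Stated for increasing, `σ`-closed lists, so that the induction can pass to the vertices `R`
  -- outside the orbit of `v`. Order makes the head `v` least in its orbit, and no other vertex of
  -- that orbit leads a cycle.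
  cycles-decompositions : ∀ k V → length V ≤ k → AllPairs Fin._<_ V → (∀ {x} → x ∈ V → σ x ∈ V) →
    map (orbit σ) (filterᵇ isLeast V) ∈ decompositions k V
  cycles-decompositions zero    []      l s cl = here refl
  cycles-decompositions (suc k) []      l s cl = here refl
  cycles-decompositions (suc k) (v ∷ V) (s≤s l) (v< ∷ s) cl =
    subst (λ F → map (orbit σ) F ∈ decompositions (suc k) (v ∷ V)) (sym filter≡)
      (∈-concatMap⁺ _ (lose (∈-shares-filter (_∈? c) V)
        (∈-concatMap⁺ _ (lose c∈perms (∈-map⁺ _
          (cycles-decompositions k R (ℕₚ.≤-trans (length-filter _ V) l) (AllPairsₚ.filter⁺ _ s) R-closed))))))
    where
    c = orbitGo σ v n (σ v)
    C = filter (_∈? c) V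
    R = filter (¬? ∘ (_∈? c)) V

    orbit⊆ : ∀ {x} → x ∈ orbit σ v → x ∈ v ∷ V
    orbit⊆ = All.lookup (orbit-⊆ cl (here refl))

    v∉V : v ∉ V
    v∉V i = ℕₚ.<-irrefl refl (All.lookup v< i)

    v-least : isLeast v ≡ true
    v-least = all-true _ (orbit σ v) λ x∈ → T⇒≡ (ℕₚ.≤⇒≤ᵇ (least (orbit⊆ x∈)))
      where
      least : ∀ {x} → x ∈ v ∷ V → toℕ v ≤ toℕ x
      least (here refl) = ℕₚ.≤-refl
      least (there i)   = ℕₚ.<⇒≤ (All.lookup v< i)

    -- The double negation is `¬ P x` for the predicate `x ∉ c`, the form in which `filterᵇ-filter`
    -- asks for it. By `orbit-sym` the smaller vertex `v` lies in the orbit of `x`.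
    not-least : ∀ {x} → x ∈ V → ¬ ¬ (x ∈ c) → isLeast x ≡ false
    not-least {x} x∈V ¬x∉c with isLeast x in eq
    ... | false = refl
    ... | true  = ⊥-elim (¬x∉c λ x∈c → ℕₚ.<⇒≱ (All.lookup v< x∈V)
      (ℕₚ.≤ᵇ⇒≤ (toℕ x) (toℕ v) (≡⇒T (all-∈ _ eq (orbit-sym {v} (there x∈c))))))

    filter≡ : filterᵇ isLeast (v ∷ V) ≡ v ∷ filterᵇ isLeast R
    filter≡ rewrite v-least = cong (v ∷_) (filterᵇ-filter isLeast (¬? ∘ (_∈? c)) V not-least)

    c∈perms : c ∈ perms C
    c∈perms with v∉c ∷ c-unique ← orbit-unique v = ∈-perms⁺ C (unique-set⇒↭ c-unique
      (Uniqueₚ.filter⁺ (_∈? c) (AllPairs.map (λ { p refl → ℕₚ.<-irrefl refl p }) s))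
      (λ x∈c → ∈-filter⁺ (_∈? c) (inV (orbit⊆ (there x∈c)) (All.lookup v∉c x∈c)) x∈c)
      (λ x∈C → proj₂ (∈-filter⁻ (_∈? c) {xs = V} x∈C)))
      where
      inV : ∀ {x} → x ∈ v ∷ V → v ≢ x → x ∈ V
      inV (here refl) v≢x = ⊥-elim (v≢x refl)
      inV (there i)   v≢x = i

    R-closed : ∀ {x} → x ∈ R → σ x ∈ R
    R-closed {x} x∈R with x∈V , x∉c ← ∈-filter⁻ (¬? ∘ (_∈? c)) {xs = V} x∈R =
      ∈-filter⁺ (¬? ∘ (_∈? c)) (inV (cl (there x∈V))) (σx∉ ∘ there)
      where
      σx∉ : σ x ∉ orbit σ v
      σx∉ i with orbit-preimage {v} i
      ... | here refl = v∉V x∈V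
      ... | there x∈c = x∉c x∈c
      inV : σ x ∈ v ∷ V → σ x ∈ V
      inV (here e)  = ⊥-elim (σx∉ (here e))
      inV (there i) = i

  cycles∈decompositions : cycles σ ∈ decompositions n (allFin n)
  cycles∈decompositions = cycles-decompositions n (allFin n) (ℕₚ.≤-reflexive (length-allFin n))
    (AllPairsₚ.tabulate⁺-< (λ p → p)) (λ {x} _ → ∈-allFin (σ x))

  ∈-cycles⁻ : ∀ {γ} → γ ∈ cycles σ → Σ (Fin n) λ i → γ ≡ orbit σ i
  ∈-cycles⁻ γ∈ with i , _ , e ← ∈-map⁻ (orbit σ) γ∈ = i , e

  -- The cycles cover all vertices because they form a decomposition of `allFin n`.
  arc-source : ∀ x → Σ (List (Fin n)) λ γ → γ ∈ cycles σ × (x , σ x) ∈ carcs γ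
  arc-source x
    with γ , x∈γ , γ∈ ← ∈-concat⁻′ (cycles σ)
           (∈-resp-↭ (↭-sym (∈-decompositions⁻ n (allFin n) cycles∈decompositions)) (∈-allFin x))
    with i , refl ← ∈-cycles⁻ γ∈
    = γ , γ∈ , subst ((x , σ x) ∈_) (sym (carcs-orbit i)) (∈-map⁺ _ x∈γ)

  arc-target : ∀ {γ x y} → γ ∈ cycles σ → (x , y) ∈ carcs γ → y ≡ σ x
  arc-target {x = x} {y} γ∈ xy∈
    with i , refl ← ∈-cycles⁻ γ∈
    with _ , _ , refl ← ∈-map⁻ _ (subst ((x , y) ∈_) (carcs-orbit i) xy∈)
    = refl

listing-injective : {w : Vec (Fin n) n} → w ∈ listings n → ∀ {i j} → lookup w i ≡ lookup w j → i ≡ j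
listing-injective {n} {w} w∈ = lookup-injective w (Unique-resp-↭ (↭-sym (∈-listings⁻ w∈)) (Uniqueₚ.allFin⁺ n))

-- A permutation is recovered from its cycles: the image of `x` is the end of the cyclic arc that
-- starts at `x`.
cycles-injective : {v w : Vec (Fin n) n} → v ∈ listings n → w ∈ listings n →
  cycles (lookup v) ≡ cycles (lookup w) → v ≡ w
cycles-injective {v = v} {w} v∈ w∈ e = lookup-ext v w λ x →
  let γ , γ∈ , arc = arc-source (lookup v) (listing-injective v∈) x
  in arc-target (lookup w) (listing-injective w∈) (subst (γ ∈_) e γ∈) arc
  where open Orbits

-- Injectivity of `cycles` suffices here: the recursion at β = 1, τ = 0 shows that there are as many
-- decompositions as listings, so no permutation has to be built from a decomposition.
cycles-listings : ∀ n → map (cycles ∘ lookup) (listings n) ↭ decompositions n (allFin n)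
cycles-listings n = unique-⊆⇒↭
  (map-unique _ (listings-unique n) cycles-injective)
  (λ i → let w , w∈ , e = ∈-map⁻ (cycles ∘ lookup) i in
    subst (_∈ decompositions n (allFin n)) (sym e) (Orbits.cycles∈decompositions (lookup w) (listing-injective w∈)))
  (ℕₚ.≤-reflexive (begin
    length (decompositions n (allFin n))        ≡⟨ length-decompositions n (allFin n) (ℕₚ.≤-reflexive (length-allFin n)) ⟩
    length (perms (allFin n))                   ≡⟨ sym (↭-length (listings-perms n)) ⟩
    length (map toList (listings n))            ≡⟨ length-map toList (listings n) ⟩
    length (listings n)                         ≡⟨ sym (length-map (cycles ∘ lookup) (listings n)) ⟩
    length (map (cycles ∘ lookup) (listings n)) ∎))

-- Both sides as the block series of all vertices

+ΣS : (f : X → Series) (xs : List X) (α : List ℕ) → + ΣS (map f xs) α ≡ ∑ xs (λ x → + f x α)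
+ΣS f []       α = sym (∑-[] _)
+ΣS f (x ∷ xs) α = trans (pos-+ (f x α) _) (trans (cong (_+_ (+ f x α)) (+ΣS f xs α)) (sym (∑-∷ x xs _)))

∑-filterᵇ : (p : X → Bool) (xs : List X) (f : X → ℤ) → ∑ (filterᵇ p xs) f ≡ ∑ xs (λ x → ⟦ p x ⟧ * f x)
∑-filterᵇ p []       f = trans (∑-[] f) (sym (∑-[] _))
∑-filterᵇ p (x ∷ xs) f with ∑-filterᵇ p xs f | ∑-∷ x xs (λ x → ⟦ p x ⟧ * f x)
... | ih | e with p x
...   | true  = trans (∑-∷ x _ f) (trans (cong₂ _+_ (sym (*-identityˡ (f x))) ih) (sym e))
...   | false = trans ih (sym (trans e (+-identityˡ _)))

-- `admissible` states its two conditions for all cycles separately; the recursion needs them joined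
-- cycle by cycle, as in `good`.
all-∧-not-any : (p q : X → Bool) (xs : List X) → all p xs ∧ not (any q xs) ≡ all (λ x → p x ∧ not (q x)) xs
all-∧-not-any p q []       = refl
all-∧-not-any p q (x ∷ xs) with p x | q x
... | false | _     = refl
... | true  | true  = ∧-zeroʳ (all p xs)
... | true  | false = all-∧-not-any p q xs

module _ {n : ℕ} (A : Fin n → Fin n → Bool) where
  open Digraph A
  open Blocks A

  U-blockSeries : ∀ α → + U A α ≡ blockSeries (allFin n) α
  U-blockSeries α = begin
    + U A α
      ≡⟨ +ΣS _ (listings n) α ⟩
    ∑ (listings n) (λ w → + L (desAt A (toList w)) n α)
      ≡⟨ ∑-ext (listings n) (λ w → trans
           (cong (λ m → + L (desAt A (toList w)) m α) (sym (length-toList w))) (L-blockWeight (toList w) α)) ⟩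
    ∑ (listings n) (λ w → blockWeight (toList w) α)
      ≡⟨ sym (∑-map toList (listings n) _) ⟩
    ∑ (map toList (listings n)) (λ w → blockWeight w α)
      ≡⟨ ∑-↭ _ (listings-perms n) ⟩
    blockSeries (allFin n) α ∎

  module _ (asym : ∀ u v → u ≢ v → A u v ≡ true → A v u ≡ true → ⊥) where
    open Asymmetric asym

    RHS-blockSeries : ∀ α → + RHS A α ≡ blockSeries (allFin n) α
    RHS-blockSeries α = begin
      + RHS A α
        ≡⟨ +ΣS _ (filterᵇ (admissible A) (listings n)) α ⟩
      ∑ (filterᵇ (admissible A) (listings n)) (λ w → + pλ (type (lookup w)) α)
        ≡⟨ ∑-filterᵇ (admissible A) (listings n) _ ⟩
      ∑ (listings n) (λ w → ⟦ admissible A w ⟧ * + pλ (type (lookup w)) α)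
        ≡⟨ ∑-ext (listings n) (λ w → cong (λ b → ⟦ b ⟧ * + pλ (type (lookup w)) α)
             (all-∧-not-any _ (risky A) (cycles (lookup w)))) ⟩
      ∑ (listings n) (λ w → term (cycles (lookup w)) α)
        ≡⟨ sym (∑-map (cycles ∘ lookup) (listings n) _) ⟩
      ∑ (map (cycles ∘ lookup) (listings n)) (λ Γ → term Γ α)
        ≡⟨ ∑-↭ _ (cycles-listings n) ⟩
      ∑ (decompositions n (allFin n)) (λ Γ → term Γ α)
        ≡⟨ decompositionSeries n (allFin n) (ℕₚ.≤-reflexive (length-allFin n)) (Uniqueₚ.allFin⁺ n) α ⟩
      blockSeries (allFin n) α ∎

    U≡RHS : ∀ α → U A α ≡ RHS A α
    U≡RHS α = +-injective (trans (U-blockSeries α) (sym (RHS-blockSeries α)))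

type-positive : (σ : Fin n → Fin n) → All (1 ≤_) (type σ)
type-positive σ = Allₚ.map⁺ (Allₚ.map⁺ (All.universal (λ i → s≤s z≤n) _))

theorem1p41 : (n : ℕ) (A : Fin n → Fin n → Bool)
    → (∀ u v → u ≢ v → A u v ≡ true → A v u ≡ true → ⊥)
    → (Σ (List (List ℕ)) (λ Λ → All (All (1 ≤_)) Λ × (∀ α → U A α ≡ ΣS (map pλ Λ) α)))
    × (∀ α → U A α ≡ RHS A α)
theorem1p41 n A asym =
  -- A list of partitions encodes a polynomial in the power sums with coefficients in ℕ. The types
  -- of the permutations in (b) form such a list, so (a) is read off from (b).
  (map (type ∘ lookup) W , Allₚ.map⁺ (All.universal (λ w → type-positive (lookup w)) W)
    , λ α → trans (U≡RHS A asym α) (cong (λ l → ΣS l α) (map-∘ W)))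
  , U≡RHS A asym
  where W = filterᵇ (admissible A) (listings n)
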